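{- For every $n\ge 2$, $E(\mathbf{C}_n\times\overleftrightarrow{K_2})=E(C_n\times\overleftrightarrow{K_2})=2n$. Moreover, $\mathbf{C}_n\times\overleftrightarrow{K_2}$ and $C_n\times\overleftrightarrow{K_2}$ are noncospectral sidigraphs with $2n$ vertices.
   Context: A sidigraph (signed digraph) is a pair $S=(D,\sigma)$, where $D=(V,\mathscr{A})$ is a digraph and $\sigma:\mathscr{A}\to\{ -1,1\}$. Its adjacency matrix $A(S)=(a_{ij})$ has $a_{ij}=\sigma(v_i,v_j)$ if there is an arc from $v_i$ to $v_j$ and $0$ otherwise. The energy of $S$ is $E(S)=\sum_j|\Re z_j|$, where the $z_j$ are the eigenvalues of $A(S)$ with multiplicity. Two sidigraphs on the same number of vertices are cospectral if they have the same spectrum (with multiplicities). $C_n$ (respectively $\mathbf{C}_n$) is a signed directed cycle on $n$ vertices for which the product of the signs of its arcs is $+1$ (respectively $-1$). $\overleftrightarrow{K_2}$ is the symmetric digraph on two vertices $u,v$ with arcs $(u,v)$ and $(v,u)$, both positive. The cartesian product $S_1\times S_2$ of $S_1=(V_1,A_1,\sigma_1)$ and $S_2=(V_2,A_2,\sigma_2)$ is the sidigraph on $V_1\times V_2$ with an arc from $(u_i,v_j)$ to $(u_k,v_l)$ iff either $j=l$ and $(u_i,u_k)\in A_1$ (with sign $\sigma_1(u_i,u_k)$), or $i=k$ and $(v_j,v_l)\in A_2$ (with sign $\sigma_2(v_j,v_l)$). -}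

module Defs where

open import Algebra.Bundles using (CommutativeRing; RawRing)
import Algebra.Definitions.RawMonoid as RawMonoidDefs
import Algebra.Definitions.RawSemiring as RawSemiringDefs
open import Data.Bool using (true; false; if_then_else_)
open import Data.Fin using (Fin; zero; suc; toℕ; punchIn)
import Data.Fin.Properties as Fin
open import Data.List using (List; foldr; map; length)
open import Data.Maybe using (Maybe; just; nothing; maybe′; _<∣>_)
open import Data.Nat using (ℕ; zero; suc)
import Data.Nat as ℕ
open import Data.Nat.DivMod using (_mod_)
open import Data.Product using (∃; ∃-syntax; _×_; _,_)
open import Data.Product.Function.NonDependent.Propositional using (_×-↔_)
open import Data.Sign using (Sign)
import Data.Sign as Sign
import Data.Vec.Functional as Vector
open import Function using (_↔_; Inverse)
open import Function.Construct.Composition using (_↔-∘_)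
open import Function.Construct.Identity using (↔-id)
open import Function.Construct.Symmetry using (↔-sym)
open import Function.Properties.Inverse using (↔⇒↣)
open import Level using (Level; _⊔_) renaming (suc to lsuc)
open import Relation.Binary using (Rel; IsDecTotalOrder; DecidableEquality)
open import Relation.Binary.PropositionalEquality using (_≡_; refl)
open import Relation.Nullary using (¬_)
open import Relation.Nullary.Decidable using (does; via-injection)

-- The standard (classical) axioms of ℝ, which determine it up to unique
-- isomorphism: an ordered field in which every nonempty subset that is
-- bounded above has a least upper bound.
record CompleteOrderedField (c ℓ : Level) : Set (lsuc (c ⊔ ℓ)) where
  field
    commutativeRing : CommutativeRing c ℓ

  open CommutativeRing commutativeRing public

  infix 4 _≤_
  field
    _≤_             : Rel Carrier ℓ
    isDecTotalOrder : IsDecTotalOrder _≈_ _≤_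
    0≉1             : ¬ (0# ≈ 1#)
    inverse         : ∀ x → ¬ (x ≈ 0#) → ∃[ y ] x * y ≈ 1#
    +-monoʳ-≤       : ∀ x {y z} → y ≤ z → x + y ≤ x + z
    *-nonneg        : ∀ {x y} → 0# ≤ x → 0# ≤ y → 0# ≤ x * y

  UpperBound : (Carrier → Set (c ⊔ ℓ)) → Carrier → Set (c ⊔ ℓ)
  UpperBound P u = ∀ x → P x → x ≤ u

  field
    supremum : (P : Carrier → Set (c ⊔ ℓ)) → ∃ P → ∃ (UpperBound P) →
               ∃[ s ] UpperBound P s × (∀ u → UpperBound P u → s ≤ u)

  open IsDecTotalOrder isDecTotalOrder public using (_≟_; _≤?_)

  ∣_∣ : Carrier → Carrier
  ∣ x ∣ = if does (0# ≤? x) then x else - x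

  fromℕ : ℕ → Carrier
  fromℕ n = RawMonoidDefs._×_ +-rawMonoid n 1#

module Complex {c ℓ} (R : CompleteOrderedField c ℓ) where
  private module ℝ = CompleteOrderedField R

  record ℂ : Set c where
    constructor _+i_
    field
      re im : ℝ.Carrier

  open ℂ public

  ℂ-rawRing : RawRing c ℓ
  ℂ-rawRing = record
    { Carrier = ℂ
    ; _≈_     = λ z w → (re z ℝ.≈ re w) × (im z ℝ.≈ im w)
    ; _+_     = λ z w → (re z ℝ.+ re w) +i (im z ℝ.+ im w)
    ; _*_     = λ z w → (re z ℝ.* re w ℝ.- im z ℝ.* im w)
                        +i (re z ℝ.* im w ℝ.+ im z ℝ.* re w)
    ; -_      = λ z → (ℝ.- re z) +i (ℝ.- im z)
    ; 0#      = ℝ.0# +i ℝ.0#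
    ; 1#      = ℝ.1# +i ℝ.0#
    }

module Matrix {c ℓ} (R : RawRing c ℓ) where
  open RawRing R
  open RawMonoidDefs +-rawMonoid using (sum)
  open RawSemiringDefs rawSemiring using (_^_)

  SquareMatrix : ℕ → Set c
  SquareMatrix n = Fin n → Fin n → Carrier

  -- Laplace expansion along the first row.
  det : ∀ {n} → SquareMatrix n → Carrier
  det {zero}  M = 1#
  det {suc n} M = sum λ j →
    (- 1#) ^ toℕ j * (M zero j * det (λ i k → M (suc i) (punchIn j k)))

  -- The value at x of the characteristic polynomial det (x I - A).
  charPoly : ∀ {n} → SquareMatrix n → Carrier → Carrier
  charPoly A x =
    det λ i j → (if does (i Fin.≟ j) then x else 0#) + - A i j

  -- zs lists the eigenvalues of A with multiplicity.  Equality of the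
  -- two polynomials is tested pointwise, which suffices over an infinite
  -- field such as ℂ.
  IsSpectrum : ∀ {n} → SquareMatrix n → List Carrier → Set (c ⊔ ℓ)
  IsSpectrum {n} A zs =
    length zs ≡ n ×
    (∀ x → charPoly A x ≈ foldr (λ z p → (x + - z) * p) 1# zs)

-- `arc u v` is `just s` if there is an arc from u to v, of sign s, and
-- `nothing` if there is none.  Without `loopless` the cartesian product
-- could have two loops of different signs at one vertex.
record Sidigraph : Set₁ where
  field
    V           : Set
    order       : ℕ
    enumeration : V ↔ Fin order
    arc         : V → V → Maybe Sign
    loopless    : ∀ v → arc v v ≡ nothing

  _≟ᵥ_ : DecidableEquality V
  _≟ᵥ_ = via-injection (↔⇒↣ enumeration) Fin._≟_

  vertexAt : Fin order → V
  vertexAt = Inverse.from enumeration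

open Sidigraph public using (V; order)

-- At most one of the two alternatives joined by _<∣>_ is an arc: if both
-- coordinates agree, neither is, by looplessness.
infixr 7 _□_
_□_ : Sidigraph → Sidigraph → Sidigraph
S □ T = record
  { V           = S.V × T.V
  ; order       = S.order ℕ.* T.order
  ; enumeration = ↔-sym Fin.*↔× ↔-∘ (S.enumeration ×-↔ T.enumeration)
  ; arc         = arc
  ; loopless    = loopless
  }
  where
  module S = Sidigraph S
  module T = Sidigraph T

  arc : S.V × T.V → S.V × T.V → Maybe Sign
  arc (u , v) (u′ , v′) =
    (if does (v T.≟ᵥ v′) then S.arc u u′ else nothing) <∣>
    (if does (u S.≟ᵥ u′) then T.arc v v′ else nothing)

  loopless : ∀ p → arc p p ≡ nothing
  loopless (u , v) rewrite S.loopless u | T.loopless v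
    with does (v T.≟ᵥ v) | does (u S.≟ᵥ u)
  ... | true  | true  = refl
  ... | true  | false = refl
  ... | false | true  = refl
  ... | false | false = refl

K₂↔ : Sidigraph
K₂↔ = record
  { V           = Fin 2
  ; order       = 2
  ; enumeration = ↔-id (Fin 2)
  ; arc         = arc
  ; loopless    = loopless
  }
  where
  arc : Fin 2 → Fin 2 → Maybe Sign
  arc u v = if does (u Fin.≟ v) then nothing else just Sign.+

  loopless : ∀ v → arc v v ≡ nothing
  loopless zero       = refl
  loopless (suc zero) = refl

next : ∀ {n} → Fin n → Fin n
next {suc n} i = suc (toℕ i) mod suc n

-- S is a signed directed cycle on n vertices, with arcs vᵢ → vᵢ₊₁ of sign
-- σᵢ (indices modulo n) and no others, and ∏ σᵢ = s.  Thus Cₙ is such an S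
-- for s = +, and 𝐂ₙ is such an S for s = -.
record IsSignedCycle (s : Sign) (n : ℕ) (S : Sidigraph) : Set where
  field
    vertices : Fin n ↔ V S
    σ        : Fin n → Sign

  v : Fin n → V S
  v = Inverse.to vertices

  field
    arcs : ∀ i j → Sidigraph.arc S (v i) (v j)
                   ≡ (if does (j Fin.≟ next i) then just (σ i) else nothing)
    sign : Vector.foldr Sign._*_ Sign.+ σ ≡ s

module Spectral {c ℓ} (R : CompleteOrderedField c ℓ) where
  private module ℝ = CompleteOrderedField R
  open Complex R public
  open RawRing ℂ-rawRing using (0#; 1#; -_)
  open Matrix ℂ-rawRing public

  signValue : Sign → ℂ
  signValue Sign.+ = 1#
  signValue Sign.- = - 1#

  adjacency : (S : Sidigraph) → SquareMatrix (order S)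
  adjacency S i j = maybe′ signValue 0# (S.arc (S.vertexAt i) (S.vertexAt j))
    where module S = Sidigraph S

  sumAbsRe : List ℂ → ℝ.Carrier
  sumAbsRe zs = foldr ℝ._+_ ℝ.0# (map (λ z → ℝ.∣ re z ∣) zs)

  -- E(S) = e.  The list of eigenvalues exists and is unique up to order,
  -- so this is the graph of the function E.
  HasEnergy : Sidigraph → ℝ.Carrier → Set (c ⊔ ℓ)
  HasEnergy S e = ∃[ zs ] IsSpectrum (adjacency S) zs × sumAbsRe zs ℝ.≈ e

  -- IsSpectrum does not depend on the order of the list, so sharing a
  -- list means having the same spectrum with multiplicities.
  Cospectral : Sidigraph → Sidigraph → Set (c ⊔ ℓ)
  Cospectral S T =
    order S ≡ order T ×
    ∃[ zs ] IsSpectrum (adjacency S) zs × IsSpectrum (adjacency T) zs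

{-# OPTIONS --safe #-}

-- Let w = 1 + i t, where t is a zero on [0, 1] of the minimum over k ≤ n of Re (1 + i t)ᵏ.  Then w has
-- argument π / 2n, so ζ = w / w̄ satisfies ζⁿ = -1 and ζ² is a primitive n-th root of unity.  If z runs
-- over the n roots of zⁿ = ±1 and τ over ±1, the vectors (ε_a zᵃ τᵇ), where ε_a is the product of the
-- signs of the first a arcs of the cycle, are eigenvectors of the product with eigenvalues z + τ, and
-- they are pairwise orthogonal; multiplicativity of the determinant then gives the characteristic
-- polynomial.  The energy is ∑ |Re z + 1| + |Re z - 1| = 2n because |z| = 1, and 2 is an eigenvalue
-- only for the positive cycle.

module Submission where

open import Defs
open import Algebra.Bundles using (CommutativeRing; RawRing)
import Algebra.Construct.NaturalChoice.Min as Minimum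
import Algebra.Properties.CommutativeMonoid.Sum as Sums
import Algebra.Properties.CommutativeSemiring.Exp as CommutativePowers
import Algebra.Properties.Ring as RingProperties
import Algebra.Properties.Semiring.Exp as Powers
import Algebra.Properties.Semiring.Mult.TCOptimised as Multiples
import Algebra.Properties.Semiring.Sum as SemiringSums
import Algebra.Solver.Ring as RingSolver
open import Algebra.Solver.Ring.AlmostCommutativeRing
  using (fromCommutativeRing; _-Raw-AlmostCommutative⟶_)
open import Data.Bool using (Bool; true; false; if_then_else_)
open import Data.Fin using (Fin; zero; suc; toℕ; fromℕ<; inject₁; punchIn; punchOut; remQuot)
import Data.Fin as Fin using (fromℕ)
import Data.Fin.Permutation as Permutation
import Data.Fin.Properties as Fin
open import Data.Fin.Relation.Unary.Top using (view; ‵fromℕ; ‵inject₁)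
import Data.Integer as ℤ
import Data.Integer.Properties as ℤ
import Data.List as List
import Data.List.Properties as List
open import Data.Maybe using (Maybe; just; nothing; maybe′; _<∣>_)
import Data.Maybe as Maybe
open import Data.Nat using (ℕ; zero; suc; z≤n; s≤s)
import Data.Nat as ℕ
import Data.Nat.DivMod as ℕ
import Data.Nat.Properties as ℕ
open import Data.Product using (∃-syntax; ∃₂; _×_; _,_; proj₁; proj₂)
open import Data.Product.Function.NonDependent.Propositional using (_×-↔_)
open import Data.Sign using (Sign)
import Data.Sign as Sign
import Data.Sign.Properties as Sign
open import Data.Sum using (_⊎_; inj₁; inj₂)
import Data.Vec.Functional as Vector
open import Data.Vec.Functional using (_∷_; insertAt)
import Data.Vec.Functional.Properties as Vector
open import Function using (_∘_; _↔_; Inverse)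
open import Function.Construct.Composition using (_↔-∘_)
open import Function.Construct.Identity using (↔-id)
open import Function.Construct.Symmetry using (↔-sym)
open import Level using (Level; Lift; lift; _⊔_)
open import Relation.Binary using (IsDecTotalOrder; TotalOrder; tri<; tri≈; tri>)
open import Relation.Binary.PropositionalEquality as ≡ using (_≡_; _≢_)
import Relation.Binary.Reasoning.Setoid as SetoidReasoning
open import Relation.Nullary using (¬_; yes; no; does; contradiction)
open import Relation.Nullary.Decidable using (dec-true; dec-false; dec⇒maybe; decidable-stable)

-- The reals are known only through the axioms of a complete ordered field, so angles and the
-- exponential are not at hand. The roots of unity come from an intermediate value argument instead,
-- in which Lipschitz bounds on `[0, 1]` take the place of continuity. The minimum over all `k`
-- matters: `Re (1 + i t)ⁿ` alone can have further zeros, such as the one where `w` has argument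
-- `3π / 2n`, and there `ζ²` is not primitive when 3 divides `n`. Passing to `w / w̄` lands on the
-- unit circle without a square root. The other obstacle is that `det` is only a recursive expansion
-- along the first row. Its multiplicativity has to be derived, and the source is that an
-- alternating function of `n` rows of length `n` is determined by its value at the identity matrix.

-- Ring solver with integer coefficients.

module IntegerSolver {c ℓ} (R : CommutativeRing c ℓ) where
  open CommutativeRing R hiding (zero)
  open RingProperties ring
  open Multiples semiring renaming (_×_ to _⊠_)
  open import Data.Integer using (ℤ; +_; -[1+_]; +[1+_]; +0; _⊖_)
  open SetoidReasoning setoid

  fromℤ : ℤ → Carrier
  fromℤ (+ n)    = n ⊠ 1#
  fromℤ -[1+ n ] = - (suc n ⊠ 1#)

  fromℤ-⊖ : ∀ m n → fromℤ (m ⊖ n) ≈ m ⊠ 1# - n ⊠ 1#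
  fromℤ-⊖ m zero = sym (trans (+-congˡ -0#≈0#) (+-identityʳ _))
  fromℤ-⊖ zero (suc n) = sym (+-identityˡ _)
  fromℤ-⊖ (suc m) (suc n) = begin
    fromℤ (suc m ⊖ suc n)            ≡⟨ ≡.cong fromℤ (ℤ.[1+m]⊖[1+n]≡m⊖n m n) ⟩
    fromℤ (m ⊖ n)                    ≈⟨ fromℤ-⊖ m n ⟩
    m ⊠ 1# - n ⊠ 1#                  ≈⟨ xyx⁻¹≈y 1# _ ⟨
    1# + (m ⊠ 1# - n ⊠ 1#) - 1#      ≈⟨ +-congʳ (+-assoc _ _ _) ⟨
    1# + m ⊠ 1# - n ⊠ 1# - 1#        ≈⟨ +-assoc _ _ _ ⟩
    1# + m ⊠ 1# + (- (n ⊠ 1#) - 1#)  ≈⟨ +-congˡ (+-comm _ _) ⟩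
    1# + m ⊠ 1# + (- 1# - n ⊠ 1#)    ≈⟨ +-congˡ (-‿+-comm _ _) ⟩
    1# + m ⊠ 1# - (1# + n ⊠ 1#)      ≈⟨ +-cong (1+× m 1#) (-‿cong (1+× n 1#)) ⟨
    suc m ⊠ 1# - suc n ⊠ 1#          ∎

  fromℤ-neg : ∀ i → fromℤ (ℤ.- i) ≈ - fromℤ i
  fromℤ-neg -[1+ n ] = sym (-‿involutive _)
  fromℤ-neg +0       = sym -0#≈0#
  fromℤ-neg +[1+ n ] = refl

  fromℤ-+ : ∀ i j → fromℤ (i ℤ.+ j) ≈ fromℤ i + fromℤ j
  fromℤ-+ (+ m)    (+ n)    = ×-homo-+ 1# m n
  fromℤ-+ (+ m)    -[1+ n ] = fromℤ-⊖ m (suc n)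
  fromℤ-+ -[1+ m ] (+ n)    = trans (fromℤ-⊖ n (suc m)) (+-comm _ _)
  fromℤ-+ -[1+ m ] -[1+ n ] = begin
    - (suc (suc (m ℕ.+ n)) ⊠ 1#)  ≡⟨ ≡.cong (λ k → - (suc k ⊠ 1#)) (ℕ.+-suc m n) ⟨
    - ((suc m ℕ.+ suc n) ⊠ 1#)    ≈⟨ -‿cong (×-homo-+ 1# (suc m) (suc n)) ⟩
    - (suc m ⊠ 1# + suc n ⊠ 1#)   ≈⟨ -‿+-comm _ _ ⟨
    - (suc m ⊠ 1#) - suc n ⊠ 1#   ∎

  fromℤ-pos-* : ∀ m j → fromℤ (+ m ℤ.* j) ≈ m ⊠ 1# * fromℤ j
  fromℤ-pos-* m (+ n) = begin
    fromℤ (+ m ℤ.* + n)  ≡⟨ ≡.cong fromℤ (ℤ.pos-* m n) ⟨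
    (m ℕ.* n) ⊠ 1#       ≈⟨ ×1-homo-* m n ⟩
    m ⊠ 1# * n ⊠ 1#      ∎
  fromℤ-pos-* m -[1+ n ] = begin
    fromℤ (+ m ℤ.* -[1+ n ])       ≡⟨ ≡.cong fromℤ (ℤ.neg-distribʳ-* (+ m) (+ suc n)) ⟨
    fromℤ (ℤ.- (+ m ℤ.* + suc n))  ≈⟨ fromℤ-neg (+ m ℤ.* + suc n) ⟩
    - fromℤ (+ m ℤ.* + suc n)      ≈⟨ -‿cong (fromℤ-pos-* m (+ suc n)) ⟩
    - (m ⊠ 1# * suc n ⊠ 1#)        ≈⟨ -‿distribʳ-* _ _ ⟩
    m ⊠ 1# * - (suc n ⊠ 1#)        ∎

  fromℤ-* : ∀ i j → fromℤ (i ℤ.* j) ≈ fromℤ i * fromℤ j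
  fromℤ-* (+ m) j = fromℤ-pos-* m j
  fromℤ-* -[1+ m ] j = begin
    fromℤ (-[1+ m ] ℤ.* j)       ≡⟨ ≡.cong fromℤ (ℤ.neg-distribˡ-* (+ suc m) j) ⟨
    fromℤ (ℤ.- (+ suc m ℤ.* j))  ≈⟨ fromℤ-neg (+ suc m ℤ.* j) ⟩
    - fromℤ (+ suc m ℤ.* j)      ≈⟨ -‿cong (fromℤ-pos-* (suc m) j) ⟩
    - (suc m ⊠ 1# * fromℤ j)     ≈⟨ -‿distribˡ-* _ _ ⟩
    - (suc m ⊠ 1#) * fromℤ j     ∎

  -- The coefficients are integers because the solver has to see them cancel by computation, which the
  -- elements of R do not.
  morphism : ℤ.+-*-rawRing -Raw-AlmostCommutative⟶ fromCommutativeRing R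
  morphism = record
    { ⟦_⟧    = fromℤ
    ; +-homo = fromℤ-+
    ; *-homo = fromℤ-*
    ; -‿homo = fromℤ-neg
    ; 0-homo = refl
    ; 1-homo = refl
    }

  _coeff≟_ : ∀ i j → Maybe (fromℤ i ≈ fromℤ j)
  i coeff≟ j = Maybe.map (λ i≡j → reflexive (≡.cong fromℤ i≡j)) (dec⇒maybe (i ℤ.≟ j))

  open RingSolver ℤ.+-*-rawRing (fromCommutativeRing R) morphism _coeff≟_ public
    using (Polynomial; solve; _:=_; _:+_; _:*_; _:-_; :-_)
  open RingSolver ℤ.+-*-rawRing (fromCommutativeRing R) morphism _coeff≟_
    using (con)

  :0 :1 : ∀ {n} → Polynomial n
  :0 = con (+ 0)
  :1 = con (+ 1)

-- Neighbouring indices and the deletion of an index.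

-- Alternation is demanded for neighbouring rows only; other pairs are reached by swaps. The
-- inductive form follows the recursions of `punchIn` and of putting a row in front.
data Adjacent : ∀ {n} → Fin n → Fin n → Set where
  here  : ∀ {n} → Adjacent {suc (suc n)} zero (suc zero)
  there : ∀ {n} {i j : Fin n} → Adjacent i j → Adjacent (suc i) (suc j)

toℕ-adjacent : ∀ {n} {i j : Fin n} → Adjacent i j → toℕ j ≡ suc (toℕ i)
toℕ-adjacent here      = ≡.refl
toℕ-adjacent (there p) = ≡.cong suc (toℕ-adjacent p)

-- No index lies strictly between neighbours, so deleting a third index leaves them neighbours.
-- Minors thus inherit a pair of equal adjacent columns.
adjacent-punchIn : ∀ {n} {i j : Fin (suc n)} → Adjacent i j → ∀ l →
  l ≡ i ⊎ l ≡ j ⊎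
  ∃₂ λ i′ j′ → Adjacent i′ j′ × punchIn l i′ ≡ i × punchIn l j′ ≡ j
adjacent-punchIn here zero       = inj₁ ≡.refl
adjacent-punchIn here (suc zero) = inj₂ (inj₁ ≡.refl)
adjacent-punchIn {suc (suc _)} here (suc (suc l)) =
  inj₂ (inj₂ (_ , _ , here , ≡.refl , ≡.refl))
adjacent-punchIn (there p) zero = inj₂ (inj₂ (_ , _ , p , ≡.refl , ≡.refl))
adjacent-punchIn {suc _} (there p) (suc l) with adjacent-punchIn p l
... | inj₁ l≡i        = inj₁ (≡.cong suc l≡i)
... | inj₂ (inj₁ l≡j) = inj₂ (inj₁ (≡.cong suc l≡j))
... | inj₂ (inj₂ (_ , _ , q , i≡ , j≡)) =
  inj₂ (inj₂ (_ , _ , there q , ≡.cong suc i≡ , ≡.cong suc j≡))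

-- Deleting one neighbour or the other gives the same list of indices except at one place, where the
-- surviving neighbour stands. If the two columns are equal, so are the two minors.
punchIn-adjacent : ∀ {n} {i j : Fin (suc n)} → Adjacent i j → ∀ k →
  punchIn i k ≡ punchIn j k ⊎ (punchIn i k ≡ j × punchIn j k ≡ i)
punchIn-adjacent here      zero    = inj₂ (≡.refl , ≡.refl)
punchIn-adjacent here      (suc k) = inj₁ ≡.refl
punchIn-adjacent (there p) zero    = inj₁ ≡.refl
punchIn-adjacent (there p) (suc k) with punchIn-adjacent p k
... | inj₁ eq        = inj₁ (≡.cong suc eq)
... | inj₂ (eq , eq′) = inj₂ (≡.cong suc eq , ≡.cong suc eq′)

-- Determinants and alternating functions of the rows.

module Determinant {c ℓ} (R : CommutativeRing c ℓ) where
  open CommutativeRing R hiding (zero)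
  open RingProperties ring
  open Powers semiring using (_^_)
  open SemiringSums semiring using (*-distribˡ-sum; *-distribʳ-sum)
  open Sums +-commutativeMonoid public using (sum; sum-cong-≋; ∑-distrib-+; sum-permute)
  open Matrix rawRing public using (det)
  open IntegerSolver R
  open SetoidReasoning setoid

  Row : ℕ → Set c
  Row n = Fin n → Carrier

  Rows : ℕ → ℕ → Set c
  Rows m n = Fin m → Row n

  infix 4 _≋_
  _≋_ : ∀ {n} → Row n → Row n → Set ℓ
  u ≋ v = ∀ k → u k ≈ v k

  infixl 7 _·_
  _·_ : ∀ {l m n} → Rows l m → Rows m n → Rows l n
  (M · N) i k = sum λ j → M i j * N j k

  infix 8 _ᵀ
  _ᵀ : ∀ {m n} → Rows m n → Rows n m
  (M ᵀ) i j = M j i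

  -- The test is written as in `charPoly`, so that `diag (λ _ → x) i j + - A i j` is by definition
  -- the matrix whose determinant is taken there.
  diag : ∀ {n} → Row n → Rows n n
  diag d i j = if does (i Fin.≟ j) then d i else 0#

  I : ∀ {n} → Rows n n
  I = diag λ _ → 1#

  diag-≡ : ∀ {n} (d : Row n) {i j} → i ≡ j → diag d i j ≈ d i
  diag-≡ d {i} {j} i≡j rewrite dec-true (i Fin.≟ j) i≡j = refl

  diag-≢ : ∀ {n} (d : Row n) {i j} → i ≢ j → diag d i j ≈ 0#
  diag-≢ d {i} {j} i≢j rewrite dec-false (i Fin.≟ j) i≢j = refl

  sum-zero : ∀ {n} {f : Row n} → (∀ i → f i ≈ 0#) → sum f ≈ 0#
  sum-zero {zero}  f≈0 = refl
  sum-zero {suc n} f≈0 =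
    trans (+-cong (f≈0 zero) (sum-zero (f≈0 ∘ suc))) (+-identityˡ 0#)

  sum-single : ∀ {n} {f : Row n} i → (∀ j → i ≢ j → f j ≈ 0#) → sum f ≈ f i
  sum-single zero    f≈0 =
    trans (+-congˡ (sum-zero λ j → f≈0 (suc j) λ ())) (+-identityʳ _)
  sum-single (suc i) f≈0 =
    trans (+-cong (f≈0 zero λ ())
                  (sum-single i λ j i≢j → f≈0 (suc j) (i≢j ∘ Fin.suc-injective)))
          (+-identityˡ _)

  sum-linear : ∀ {n} {f g h : Row n} a → (∀ i → f i ≈ a * g i + h i) →
               sum f ≈ a * sum g + sum h
  sum-linear {f = f} {g} {h} a f≈ = begin
    sum f                               ≈⟨ sum-cong-≋ f≈ ⟩
    sum (λ i → a * g i + h i)           ≈⟨ ∑-distrib-+ (λ i → a * g i) h ⟩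
    sum (λ i → a * g i) + sum h         ≈⟨ +-congʳ (*-distribˡ-sum a g) ⟨
    a * sum g + sum h                   ∎

  sum-cancel : ∀ {n} {f : Row n} {i j} → Adjacent i j → f i + f j ≈ 0# →
               (∀ l → l ≢ i → l ≢ j → f l ≈ 0#) → sum f ≈ 0#
  sum-cancel {f = f} here f₀+f₁≈0 f≈0 = begin
    f zero + (f (suc zero) + s)   ≈⟨ +-assoc _ _ _ ⟨
    f zero + f (suc zero) + s     ≈⟨ +-cong f₀+f₁≈0 (sum-zero λ l → f≈0 (suc (suc l)) (λ ()) (λ ())) ⟩
    0# + 0#                       ≈⟨ +-identityˡ 0# ⟩
    0#                            ∎
    where s = sum λ l → f (suc (suc l))
  sum-cancel (there p) fᵢ+fⱼ≈0 f≈0 =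
    trans (+-cong (f≈0 zero (λ ()) (λ ()))
                  (sum-cancel p fᵢ+fⱼ≈0 λ l l≢i l≢j →
                    f≈0 (suc l) (l≢i ∘ Fin.suc-injective) (l≢j ∘ Fin.suc-injective)))
          (+-identityˡ 0#)

  -- The number of rows is independent of their length, so that fixing the first row yields a
  -- function of the same kind. Linearity relates any three matrices that agree off row `i`, which
  -- avoids an update operation on matrices.
  record IsAlternating {m n} (D : Rows m n → Carrier) : Set (c ⊔ ℓ) where
    field
      D-cong        : ∀ {M N} → (∀ i → M i ≋ N i) → D M ≈ D N
      D-linear      : ∀ i a {L M N} →
                      (∀ j → j ≢ i → L j ≋ M j) → (∀ j → j ≢ i → L j ≋ N j) →
                      (∀ k → L i k ≈ a * M i k + N i k) → D L ≈ a * D M + D N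
      D-alternating : ∀ {i j} → Adjacent i j → ∀ {M} → M i ≋ M j → D M ≈ 0#

  open IsAlternating

  minor : ∀ {n} → Fin (suc n) → Rows (suc n) (suc n) → Rows n n
  minor j M i k = M (suc i) (punchIn j k)

  laplaceTerm : ∀ {n} → Rows (suc n) (suc n) → Row (suc n)
  laplaceTerm M j = (- 1#) ^ toℕ j * (M zero j * det (minor j M))

  det-cong : ∀ {n} {M N : Rows n n} → (∀ i → M i ≋ N i) → det M ≈ det N
  det-cong {zero}  M≋N = refl
  det-cong {suc n} M≋N = sum-cong-≋ λ j →
    *-congˡ {(- 1#) ^ toℕ j} (*-cong (M≋N zero j) (det-cong λ i k → M≋N (suc i) (punchIn j k)))

  -- Each Laplace term has exactly one factor from column `k`: the entry in front if `j` is `k`, and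
  -- otherwise column `punchOut j≢k` inside the minor.
  det-linear-column : ∀ {n} k a {L M N : Rows n n} →
    (∀ j → j ≢ k → ∀ i → L i j ≈ M i j) → (∀ j → j ≢ k → ∀ i → L i j ≈ N i j) →
    (∀ i → L i k ≈ a * M i k + N i k) → det L ≈ a * det M + det N
  det-linear-column {suc n} k a {L} {M} {N} L≋M L≋N Lₖ≈ =
    sum-linear {f = laplaceTerm L} {laplaceTerm M} {laplaceTerm N} a term
    where
    s : Fin (suc n) → Carrier
    s j = (- 1#) ^ toℕ j

    term : ∀ j → laplaceTerm L j ≈ a * laplaceTerm M j + laplaceTerm N j
    term j with j Fin.≟ k
    ... | yes ≡.refl = begin
      s j * (L zero j * det (minor j L))
        ≈⟨ *-congˡ (*-cong (Lₖ≈ zero) (det-cong λ i l → L≋M _ (Fin.punchInᵢ≢i j l) (suc i))) ⟩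
      s j * ((a * M zero j + N zero j) * det (minor j M))
        ≈⟨ solve 5 (λ s a m n d → s :* ((a :* m :+ n) :* d) := a :* (s :* (m :* d)) :+ s :* (n :* d))
             refl (s j) a (M zero j) (N zero j) (det (minor j M)) ⟩
      a * (s j * (M zero j * det (minor j M))) + s j * (N zero j * det (minor j M))
        ≈⟨ +-congˡ (*-congˡ (*-congˡ (det-cong λ i l →
             trans (sym (L≋M _ (Fin.punchInᵢ≢i j l) (suc i))) (L≋N _ (Fin.punchInᵢ≢i j l) (suc i))))) ⟩
      a * (s j * (M zero j * det (minor j M))) + s j * (N zero j * det (minor j N)) ∎
    ... | no j≢k = begin
      s j * (L zero j * det (minor j L))
        ≈⟨ *-congˡ (*-congˡ (det-linear-column k′ a
             (λ l l≢k′ i → L≋M _ (punchIn≢k l≢k′) (suc i))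
             (λ l l≢k′ i → L≋N _ (punchIn≢k l≢k′) (suc i))
             (λ i → ≡.subst (λ k → L (suc i) k ≈ a * M (suc i) k + N (suc i) k)
                      (≡.sym (Fin.punchIn-punchOut j≢k)) (Lₖ≈ (suc i))))) ⟩
      s j * (L zero j * (a * det (minor j M) + det (minor j N)))
        ≈⟨ solve 5 (λ s l a d e → s :* (l :* (a :* d :+ e)) := a :* (s :* (l :* d)) :+ s :* (l :* e))
             refl (s j) (L zero j) a (det (minor j M)) (det (minor j N)) ⟩
      a * (s j * (L zero j * det (minor j M))) + s j * (L zero j * det (minor j N))
        ≈⟨ +-cong (*-congˡ (*-congˡ (*-congʳ (L≋M j j≢k zero)))) (*-congˡ (*-congʳ (L≋N j j≢k zero))) ⟩
      a * (s j * (M zero j * det (minor j M))) + s j * (N zero j * det (minor j N)) ∎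
      where
      k′ = punchOut j≢k
      punchIn≢k : ∀ {l} → l ≢ k′ → punchIn j l ≢ k
      punchIn≢k l≢k′ eq = l≢k′ (Fin.punchIn-injective j _ _
        (≡.trans eq (≡.sym (Fin.punchIn-punchOut j≢k))))

  -- The terms of the two equal columns have equal minors and opposite signs, hence cancel; every
  -- other minor still contains both columns, as neighbours.
  det-alternating-column : ∀ {n} {k l : Fin n} → Adjacent k l → ∀ {M : Rows n n} →
    (∀ i → M i k ≈ M i l) → det M ≈ 0#
  det-alternating-column {suc n} {k} {l} p {M} Mₖ≈Mₗ = sum-cancel {f = laplaceTerm M} p cancel vanish
    where
    minorₖ≋minorₗ : ∀ i → minor k M i ≋ minor l M i
    minorₖ≋minorₗ i j with punchIn-adjacent p j
    ... | inj₁ eq         = reflexive (≡.cong (M (suc i)) eq)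
    ... | inj₂ (eq , eq′) rewrite eq | eq′ = sym (Mₖ≈Mₗ (suc i))

    cancel : laplaceTerm M k + laplaceTerm M l ≈ 0#
    cancel rewrite toℕ-adjacent p = begin
      s * (M zero k * det (minor k M)) + - 1# * s * (M zero l * det (minor l M))
        ≈⟨ +-congʳ (*-congˡ (*-cong (Mₖ≈Mₗ zero) (det-cong minorₖ≋minorₗ))) ⟩
      s * (M zero l * det (minor l M)) + - 1# * s * (M zero l * det (minor l M))
        ≈⟨ solve 3 (λ s m d → s :* (m :* d) :+ (:- :1) :* s :* (m :* d) := :0)
             refl s (M zero l) (det (minor l M)) ⟩
      0# ∎
      where s = (- 1#) ^ toℕ k

    vanish : ∀ j → j ≢ k → j ≢ l → laplaceTerm M j ≈ 0#
    vanish j j≢k j≢l with adjacent-punchIn p j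
    ... | inj₁ j≡k        = contradiction j≡k j≢k
    ... | inj₂ (inj₁ j≡l) = contradiction j≡l j≢l
    ... | inj₂ (inj₂ (k′ , l′ , q , k≡ , l≡)) = begin
      (- 1#) ^ toℕ j * (M zero j * det (minor j M))
        ≈⟨ *-congˡ (*-congˡ (det-alternating-column q λ i → equal i)) ⟩
      (- 1#) ^ toℕ j * (M zero j * 0#)
        ≈⟨ solve 2 (λ s m → s :* (m :* :0) := :0) refl _ (M zero j) ⟩
      0# ∎
      where
      equal : ∀ i → minor j M i k′ ≈ minor j M i l′
      equal i rewrite k≡ | l≡ = Mₖ≈Mₗ (suc i)

  -- Expansion along the first row behaves well in the columns of a matrix; the statement for its rows
  -- comes out of alternating-unique, which yields det (Mᵀ) = det M.
  detᵀ-isAlternating : ∀ {n} → IsAlternating {n} {n} (λ M → det (M ᵀ))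
  detᵀ-isAlternating = record
    { D-cong        = λ M≋N → det-cong λ i k → M≋N k i
    ; D-linear      = λ i a {L} {M} {N} → det-linear-column i a {L ᵀ} {M ᵀ} {N ᵀ}
    ; D-alternating = λ p {M} → det-alternating-column p {M ᵀ}
    }

  module _ {m n} {D : Rows (suc m) n → Carrier} (alt : IsAlternating D) where

    ∷-cong : ∀ {u v M N} → u ≋ v → (∀ i → M i ≋ N i) → D (u ∷ M) ≈ D (v ∷ N)
    ∷-cong u≋v M≋N = D-cong alt λ { zero → u≋v ; (suc i) → M≋N i }

    ∷-congˡ : ∀ {u M N} → (∀ i → M i ≋ N i) → D (u ∷ M) ≈ D (u ∷ N)
    ∷-congˡ = ∷-cong λ _ → refl

    head∷tail : ∀ {M} → D M ≈ D (M zero ∷ M ∘ suc)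
    head∷tail = D-cong alt λ { zero _ → refl ; (suc i) _ → refl }

    ∷-isAlternating : ∀ u → IsAlternating (λ M → D (u ∷ M))
    ∷-isAlternating u = record
      { D-cong        = ∷-congˡ
      ; D-linear      = λ i a L≋M L≋N L≈ → D-linear alt (suc i) a
          (λ { zero _ _ → refl ; (suc j) j≢i → L≋M j (j≢i ∘ ≡.cong suc) })
          (λ { zero _ _ → refl ; (suc j) j≢i → L≋N j (j≢i ∘ ≡.cong suc) })
          L≈
      ; D-alternating = λ p → D-alternating alt (there p)
      }

    ∷-linear : ∀ a {u v w M} → (∀ k → u k ≈ a * v k + w k) →
               D (u ∷ M) ≈ a * D (v ∷ M) + D (w ∷ M)
    ∷-linear a u≈ = D-linear alt zero a
      (λ { zero 0≢0 → contradiction ≡.refl 0≢0 ; (suc j) _ _ → refl })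
      (λ { zero 0≢0 → contradiction ≡.refl 0≢0 ; (suc j) _ _ → refl })
      u≈

    -- Linearity comes in the single form `a * v + w`, so a vanishing row `u` is written as
    -- `- 1# * u + u`.
    ∷-zero : ∀ {u M} → (∀ k → u k ≈ 0#) → D (u ∷ M) ≈ 0#
    ∷-zero {u} {M} u≈0 = begin
      D (u ∷ M)                     ≈⟨ ∷-linear (- 1#) (λ k → trans (u≈0 k) (sym (cancel (u k)))) ⟩
      - 1# * D (u ∷ M) + D (u ∷ M)  ≈⟨ cancel (D (u ∷ M)) ⟩
      0#                            ∎
      where
      cancel : ∀ x → - 1# * x + x ≈ 0#
      cancel = solve 1 (λ x → (:- :1) :* x :+ x := :0) refl

    ∷-sum : ∀ {p} (a : Row p) (w : Rows p n) {u M} → (∀ k → u k ≈ sum λ j → a j * w j k) →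
            D (u ∷ M) ≈ sum λ j → a j * D (w j ∷ M)
    ∷-sum {zero}  a w u≈ = ∷-zero u≈
    ∷-sum {suc p} a w u≈ =
      trans (∷-linear (a zero) u≈) (+-congˡ (∷-sum (a ∘ suc) (w ∘ suc) λ _ → refl))

  -- Polarisation: expand the vanishing value at `u+v ∷ u+v ∷ M`. The factors `1#` only fit the sum
  -- to the form of `D-linear`.
  ∷-swap : ∀ {m n} {D : Rows (suc (suc m)) n → Carrier} → IsAlternating D →
           ∀ u v M → D (u ∷ v ∷ M) ≈ - D (v ∷ u ∷ M)
  ∷-swap {D = D} alt u v M = begin
    D (u ∷ v ∷ M)
      ≈⟨ solve 2 (λ x y → x := (:1 :* (:1 :* :0 :+ x) :+ (:1 :* y :+ :0)) :- y) refl _ (D (v ∷ u ∷ M)) ⟩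
    (1# * (1# * 0# + D (u ∷ v ∷ M)) + (1# * D (v ∷ u ∷ M) + 0#)) - D (v ∷ u ∷ M)
      ≈⟨ +-congʳ (+-cong (*-congˡ (+-congʳ (*-congˡ (repeated u)))) (+-congˡ (repeated v))) ⟨
    (1# * (1# * D (u ∷ u ∷ M) + D (u ∷ v ∷ M)) + (1# * D (v ∷ u ∷ M) + D (v ∷ v ∷ M))) - D (v ∷ u ∷ M)
      ≈⟨ +-congʳ (+-cong (*-congˡ (expand u)) (expand v)) ⟨
    (1# * D (u ∷ u+v ∷ M) + D (v ∷ u+v ∷ M)) - D (v ∷ u ∷ M)
      ≈⟨ +-congʳ (∷-linear alt 1# (λ _ → refl)) ⟨
    D (u+v ∷ u+v ∷ M) - D (v ∷ u ∷ M)
      ≈⟨ +-congʳ (repeated u+v) ⟩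
    0# - D (v ∷ u ∷ M)
      ≈⟨ +-identityˡ _ ⟩
    - D (v ∷ u ∷ M) ∎
    where
    u+v : Row _
    u+v k = 1# * u k + v k

    repeated : ∀ w → D (w ∷ w ∷ M) ≈ 0#
    repeated w = D-alternating alt here λ _ → refl

    expand : ∀ w → D (w ∷ u+v ∷ M) ≈ 1# * D (w ∷ u ∷ M) + D (w ∷ v ∷ M)
    expand w = ∷-linear (∷-isAlternating alt w) 1# λ _ → refl

  -- Swaps carry `u` down, past rows that are then held fixed, until it stands next to its copy.
  ∷-repeated : ∀ {m n} {D : Rows (suc m) n → Carrier} → IsAlternating D →
               ∀ {u M} j → M j ≋ u → D (u ∷ M) ≈ 0#
  ∷-repeated alt {u} {M} zero Mⱼ≋u = D-alternating alt here λ k → sym (Mⱼ≋u k)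
  ∷-repeated {D = D} alt {u} {M} (suc j) Mⱼ≋u = begin
    D (u ∷ M)                       ≈⟨ ∷-congˡ alt (λ { zero _ → refl ; (suc i) _ → refl }) ⟩
    D (u ∷ M zero ∷ M ∘ suc)        ≈⟨ ∷-swap alt _ _ _ ⟩
    - D (M zero ∷ u ∷ M ∘ suc)      ≈⟨ -‿cong (∷-repeated (∷-isAlternating alt (M zero)) j Mⱼ≋u) ⟩
    - 0#                            ≈⟨ -0#≈0# ⟩
    0#                              ∎

  -- Moving row `j` to the front takes `j` swaps, which is where the signs of the Laplace expansion
  -- come from.
  ∷-punchIn : ∀ {m n} {D : Rows (suc m) n → Carrier} → IsAlternating D →
              ∀ j M → D (M j ∷ M ∘ punchIn j) ≈ (- 1#) ^ toℕ j * D M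
  ∷-punchIn alt zero M = trans (sym (head∷tail alt)) (sym (*-identityˡ _))
  ∷-punchIn {suc m} {D = D} alt (suc j) M = begin
    D (M (suc j) ∷ M ∘ punchIn (suc j))
      ≈⟨ ∷-congˡ alt (λ { zero _ → refl ; (suc i) _ → refl }) ⟩
    D (M (suc j) ∷ M zero ∷ M ∘ suc ∘ punchIn j)
      ≈⟨ ∷-swap alt _ _ _ ⟩
    - D (M zero ∷ M (suc j) ∷ M ∘ suc ∘ punchIn j)
      ≈⟨ -‿cong (∷-punchIn (∷-isAlternating alt (M zero)) j (M ∘ suc)) ⟩
    - ((- 1#) ^ toℕ j * D (M zero ∷ M ∘ suc))
      ≈⟨ -‿cong (*-congˡ (head∷tail alt)) ⟨
    - ((- 1#) ^ toℕ j * D M)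
      ≈⟨ solve 2 (λ s d → :- (s :* d) := (:- :1) :* s :* d) refl _ _ ⟩
    - 1# * (- 1#) ^ toℕ j * D M ∎

  -- In the application `D` already has `u` fixed as its first row. Only the vanishing at a copy of
  -- `u` is kept as hypothesis, because this survives when further rows are fixed in the induction.
  add-multiples : ∀ {m n} {D : Rows m n → Carrier} → IsAlternating D →
    ∀ {u} → (∀ {M} j → M j ≋ u → D M ≈ 0#) →
    ∀ (a : Row m) M → D (λ i k → a i * u k + M i k) ≈ D M
  add-multiples {zero}  alt D≈0 a M = D-cong alt λ ()
  add-multiples {suc m} {D = D} alt {u} D≈0 a M = begin
    D M′                                             ≈⟨ head∷tail alt ⟩
    D (M′ zero ∷ M′ ∘ suc)                           ≈⟨ ∷-linear alt (a zero) (λ _ → refl) ⟩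
    a zero * D (u ∷ M′ ∘ suc) + D (M zero ∷ M′ ∘ suc)
      ≈⟨ +-cong (*-congˡ (D≈0 zero λ _ → refl))
           (add-multiples (∷-isAlternating alt (M zero)) (λ j → D≈0 (suc j)) (a ∘ suc) (M ∘ suc)) ⟩
    a zero * 0# + D (M zero ∷ M ∘ suc)               ≈⟨ +-congʳ (zeroʳ _) ⟩
    0# + D (M zero ∷ M ∘ suc)                        ≈⟨ +-identityˡ _ ⟩
    D (M zero ∷ M ∘ suc)                             ≈⟨ head∷tail alt ⟨
    D M                                              ∎
    where
    M′ : Rows _ _
    M′ i k = a i * u k + M i k

  record IsLinear {m n} (φ : Row m → Row n) : Set (c ⊔ ℓ) where
    field
      φ-cong   : ∀ {u v} → u ≋ v → φ u ≋ φ v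
      φ-linear : ∀ a {u v w} → (∀ k → u k ≈ a * v k + w k) →
                 ∀ k → φ u k ≈ a * φ v k + φ w k

  ∘-isAlternating : ∀ {l m n} {D : Rows l n → Carrier} {φ : Row m → Row n} →
    IsAlternating D → IsLinear φ → IsAlternating (λ M → D (φ ∘ M))
  ∘-isAlternating alt lin = record
    { D-cong        = λ M≋N → D-cong alt λ i → φ-cong (M≋N i)
    ; D-linear      = λ i a L≋M L≋N L≈ → D-linear alt i a
        (λ j j≢i → φ-cong (L≋M j j≢i)) (λ j j≢i → φ-cong (L≋N j j≢i)) (φ-linear a L≈)
    ; D-alternating = λ p Mᵢ≋Mⱼ → D-alternating alt p (φ-cong Mᵢ≋Mⱼ)
    }
    where open IsLinear lin

  punchIn-cases : ∀ {n} {p} {P : Fin (suc n) → Set p} j → P j → (∀ k → P (punchIn j k)) → ∀ k → P k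
  punchIn-cases {P = P} j Pⱼ Pₖ k with j Fin.≟ k
  ... | yes ≡.refl = Pⱼ
  ... | no j≢k     = ≡.subst P (Fin.punchIn-punchOut j≢k) (Pₖ (punchOut j≢k))

  insert0 : ∀ {n} → Fin (suc n) → Row n → Row (suc n)
  insert0 j u = insertAt u j 0#

  insert0-at : ∀ {n} j (u : Row n) → insert0 j u j ≈ 0#
  insert0-at j u = reflexive (Vector.insertAt-lookup u j 0#)

  insert0-punchIn : ∀ {n} j (u : Row n) k → insert0 j u (punchIn j k) ≈ u k
  insert0-punchIn j u k = reflexive (Vector.insertAt-punchIn u j 0# k)

  insert0-isLinear : ∀ {n} (j : Fin (suc n)) → IsLinear (insert0 j)
  insert0-isLinear j = record
    { φ-cong   = λ {u} {v} u≋v → punchIn-cases j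
        (trans (insert0-at j u) (sym (insert0-at j v)))
        (λ k → trans (insert0-punchIn j u k) (trans (u≋v k) (sym (insert0-punchIn j v k))))
    ; φ-linear = λ a {u} {v} {w} u≈ → punchIn-cases j
        (begin
          insert0 j u j                        ≈⟨ insert0-at j u ⟩
          0#                                   ≈⟨ solve 1 (λ a → :0 := a :* :0 :+ :0) refl a ⟩
          a * 0# + 0#                          ≈⟨ +-cong (*-congˡ (insert0-at j v)) (insert0-at j w) ⟨
          a * insert0 j v j + insert0 j w j    ∎)
        (λ k → trans (insert0-punchIn j u k) (trans (u≈ k)
          (sym (+-cong (*-congˡ (insert0-punchIn j v k)) (insert0-punchIn j w k)))))
    }

  I-punchIn : ∀ {n} j i → insert0 j (I {n} i) ≋ I (punchIn j i)
  I-punchIn j i = punchIn-cases j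
    (trans (insert0-at j (I i)) (sym (diag-≢ _ (Fin.punchInᵢ≢i j i))))
    λ k → trans (insert0-punchIn j (I i) k) (δ k)
    where
    δ : ∀ k → I i k ≈ I (punchIn j i) (punchIn j k)
    δ k with i Fin.≟ k
    ... | yes ≡.refl = sym (diag-≡ _ {punchIn j i} ≡.refl)
    ... | no i≢k     = sym (diag-≢ _ (i≢k ∘ Fin.punchIn-injective j i k))

  -- Expand the first row of M; with I j in front, column j of the other rows can be cleared.
  alternating-unique : ∀ {n} {D : Rows n n → Carrier} → IsAlternating D →
                       ∀ M → D M ≈ det M * D I
  alternating-unique {zero}  alt M = trans (D-cong alt λ ()) (sym (*-identityˡ _))
  alternating-unique {suc n} {D} alt M = begin
    D M
      ≈⟨ head∷tail alt ⟩
    D (M zero ∷ M ∘ suc)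
      ≈⟨ ∷-sum alt (M zero) I (λ k → sym (trans
           (sum-single {f = λ j → M zero j * I j k} k
             (λ j k≢j → trans (*-congˡ (diag-≢ _ (k≢j ∘ ≡.sym))) (zeroʳ _)))
           (trans (*-congˡ (diag-≡ _ {k} ≡.refl)) (*-identityʳ _)))) ⟩
    sum (λ j → M zero j * D (I j ∷ M ∘ suc))
      ≈⟨ sum-cong-≋ (λ j → *-congˡ {M zero j} (expand j)) ⟩
    sum (λ j → M zero j * (det (minor j M) * ((- 1#) ^ toℕ j * D I)))
      ≈⟨ sum-cong-≋ (λ j → solve 4 (λ m d s e → m :* (d :* (s :* e)) := s :* (m :* d) :* e)
           refl (M zero j) (det (minor j M)) ((- 1#) ^ toℕ j) (D I)) ⟩
    sum (λ j → laplaceTerm M j * D I)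
      ≈⟨ *-distribʳ-sum (D I) (laplaceTerm M) ⟨
    det M * D I ∎
    where
    clear : ∀ j i → (λ k → - M (suc i) j * I j k + M (suc i) k) ≋ insert0 j (minor j M i)
    clear j i = punchIn-cases j
      (begin
        - M (suc i) j * I j j + M (suc i) j  ≈⟨ +-congʳ (*-congˡ (diag-≡ _ {j} ≡.refl)) ⟩
        - M (suc i) j * 1# + M (suc i) j     ≈⟨ solve 1 (λ m → (:- m) :* :1 :+ m := :0) refl _ ⟩
        0#                                   ≈⟨ insert0-at j _ ⟨
        insert0 j (minor j M i) j            ∎)
      λ k → begin
        - M (suc i) j * I j (punchIn j k) + minor j M i k
          ≈⟨ +-congʳ (*-congˡ (diag-≢ _ (Fin.punchInᵢ≢i j k ∘ ≡.sym))) ⟩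
        - M (suc i) j * 0# + minor j M i k
          ≈⟨ solve 2 (λ m n → (:- m) :* :0 :+ n := n) refl _ _ ⟩
        minor j M i k
          ≈⟨ insert0-punchIn j _ k ⟨
        insert0 j (minor j M i) (punchIn j k) ∎

    expand : ∀ j → D (I j ∷ M ∘ suc) ≈ det (minor j M) * ((- 1#) ^ toℕ j * D I)
    expand j = begin
      D (I j ∷ M ∘ suc)
        ≈⟨ add-multiples (∷-isAlternating alt (I j)) (∷-repeated alt) (λ i → - M (suc i) j) (M ∘ suc) ⟨
      D (I j ∷ λ i k → - M (suc i) j * I j k + M (suc i) k)
        ≈⟨ ∷-congˡ alt (clear j) ⟩
      D (I j ∷ insert0 j ∘ minor j M)
        -- With `I j` fixed and a zero column reinserted at `j`, `D` is an alternating function of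
        -- the minor, which is one size smaller.
        ≈⟨ alternating-unique
             (∘-isAlternating (∷-isAlternating alt (I j)) (insert0-isLinear j)) (minor j M) ⟩
      det (minor j M) * D (I j ∷ insert0 j ∘ I)
        ≈⟨ *-congˡ (∷-congˡ alt (I-punchIn j)) ⟩
      det (minor j M) * D (I j ∷ I ∘ punchIn j)
        ≈⟨ *-congˡ (∷-punchIn alt j I) ⟩
      det (minor j M) * ((- 1#) ^ toℕ j * D I) ∎

  det-diag : ∀ {n} (d : Row n) → det (diag d) ≈ Vector.foldr _*_ 1# d
  det-diag {zero}  d = refl
  det-diag {suc n} d = begin
    det (diag d)
      ≈⟨ sum-single {f = laplaceTerm (diag d)} zero (λ { zero 0≢0 → contradiction ≡.refl 0≢0
                            ; (suc j) _ → trans (*-congˡ (zeroˡ _)) (zeroʳ _) }) ⟩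
    1# * (d zero * det (diag (d ∘ suc)))
      ≈⟨ *-identityˡ _ ⟩
    d zero * det (diag (d ∘ suc))
      ≈⟨ *-congˡ (det-diag (d ∘ suc)) ⟩
    d zero * Vector.foldr _*_ 1# (d ∘ suc) ∎

  det-I : ∀ n → det (I {n}) ≈ 1#
  det-I n = trans (det-diag {n} _) (ones n)
    where
    ones : ∀ n → Vector.foldr _*_ 1# {n} (λ _ → 1#) ≈ 1#
    ones zero    = refl
    ones (suc n) = trans (*-identityˡ _) (ones n)

  det-transpose : ∀ {n} (M : Rows n n) → det (M ᵀ) ≈ det M
  det-transpose {n} M = begin
    det (M ᵀ)            ≈⟨ alternating-unique detᵀ-isAlternating M ⟩
    det M * det (I {n} ᵀ)  ≈⟨ *-congˡ (trans (det-cong symmetric) (det-I n)) ⟩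
    det M * 1#           ≈⟨ *-identityʳ _ ⟩
    det M                ∎
    where
    symmetric : ∀ i → (I {n} ᵀ) i ≋ I i
    symmetric i j with i Fin.≟ j
    ... | yes ≡.refl = diag-≡ _ {i} ≡.refl
    ... | no i≢j     = diag-≢ _ (i≢j ∘ ≡.sym)

  det-isAlternating : ∀ {n} → IsAlternating {n} {n} det
  det-isAlternating = record
    { D-cong        = det-cong
    ; D-linear      = λ i a {L} {M} {N} L≋M L≋N L≈ →
        trans (sym (det-transpose L)) (trans (D-linear detᵀ-isAlternating i a L≋M L≋N L≈)
          (+-cong (*-congˡ (det-transpose M)) (det-transpose N)))
    ; D-alternating = λ p {M} Mᵢ≋Mⱼ →
        trans (sym (det-transpose M)) (D-alternating detᵀ-isAlternating p Mᵢ≋Mⱼ)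
    }

  -- For fixed `N`, the function sending `M` to `det (M · N)` is alternating, and its value at `I`
  -- is `det N`.
  det-· : ∀ {n} (M N : Rows n n) → det (M · N) ≈ det M * det N
  det-· {n} M N = trans
    (alternating-unique (∘-isAlternating det-isAlternating ·N-isLinear) M)
    (*-congˡ (det-cong I·N≋N))
    where
    ·N-isLinear : IsLinear λ u k → sum λ j → u j * N j k
    ·N-isLinear = record
      { φ-cong   = λ u≋v k → sum-cong-≋ λ j → *-congʳ (u≋v j)
      ; φ-linear = λ a {u} {v} {w} u≈ k → sum-linear a λ j → trans (*-congʳ (u≈ j))
          (solve 4 (λ a v w n → (a :* v :+ w) :* n := a :* (v :* n) :+ w :* n) refl a (v j) (w j) (N j k))
      }

    I·N≋N : ∀ i → (I · N) i ≋ N i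
    I·N≋N i k = trans
      (sum-single {f = λ j → I i j * N j k} i λ j i≢j → trans (*-congʳ (diag-≢ _ i≢j)) (zeroˡ _))
      (trans (*-congʳ (diag-≡ _ {i} ≡.refl)) (*-identityˡ _))

-- Ordered fields, Lipschitz functions and intermediate values.

module OrderedField {c ℓ} (F : CompleteOrderedField c ℓ) where
  open CompleteOrderedField F public hiding (zero)
  open IsDecTotalOrder isDecTotalOrder public
    using (total; antisym)
    renaming (refl to ≤-refl; reflexive to ≤-reflexive; trans to ≤-trans; isTotalOrder to ≤-isTotalOrder)
  open RingProperties ring public
  open IntegerSolver commutativeRing public

  ≤-totalOrder : TotalOrder c ℓ ℓ
  ≤-totalOrder = record { isTotalOrder = ≤-isTotalOrder }

  open Minimum ≤-totalOrder public using (_⊓_; x⊓y≤x; x⊓y≤y; ⊓-glb; ⊓-sel)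

  infix 4 _<_
  -- As a negation, a strict inequality is refuted by applying it to the reverse weak one; most
  -- contradictions below have this shape.
  _<_ : Carrier → Carrier → Set ℓ
  x < y = ¬ (y ≤ x)

  <⇒≤ : ∀ {x y} → x < y → x ≤ y
  <⇒≤ {x} {y} x<y with total x y
  ... | inj₁ x≤y = x≤y
  ... | inj₂ y≤x = contradiction y≤x x<y

  ≮⇒≥ : ∀ {x y} → ¬ (x < y) → y ≤ x
  ≮⇒≥ {x} {y} = decidable-stable (y ≤? x)

  <⇒≉ : ∀ {x y} → x < y → ¬ (y ≈ x)
  <⇒≉ x<y y≈x = x<y (≤-reflexive y≈x)

  <-respʳ-≈ : ∀ {x y z} → y ≈ z → x < y → x < z
  <-respʳ-≈ y≈z x<y z≤x = x<y (≤-trans (≤-reflexive y≈z) z≤x)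

  ≤∧≉⇒< : ∀ {x y} → x ≤ y → ¬ (y ≈ x) → x < y
  ≤∧≉⇒< x≤y y≉x y≤x = y≉x (antisym y≤x x≤y)

  -- The standard way to an inequality below: the solver identifies `y - x` with an expression `p`
  -- assembled from nonnegative pieces.
  0≤⇒≤ : ∀ {x y p} → 0# ≤ p → y - x ≈ p → x ≤ y
  0≤⇒≤ {x} {y} {p} 0≤p y-x≈p = ≤-trans
    (≤-reflexive (sym (+-identityʳ x)))
    (≤-trans (+-monoʳ-≤ x (≤-trans 0≤p (≤-reflexive (sym y-x≈p))))
      (≤-reflexive (solve 2 (λ x y → x :+ (y :- x) := y) refl x y)))

  ≤⇒0≤ : ∀ {x y} → x ≤ y → 0# ≤ y - x
  ≤⇒0≤ {x} {y} x≤y = ≤-trans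
    (≤-reflexive (sym (-‿inverseˡ x)))
    (≤-trans (+-monoʳ-≤ (- x) x≤y) (≤-reflexive (+-comm _ _)))

  +-nonneg : ∀ {x y} → 0# ≤ x → 0# ≤ y → 0# ≤ x + y
  +-nonneg {x} {y} 0≤x 0≤y = ≤-trans 0≤x
    (≤-trans (≤-reflexive (sym (+-identityʳ x))) (+-monoʳ-≤ x 0≤y))

  square-nonneg : ∀ x → 0# ≤ x * x
  square-nonneg x with total 0# x
  ... | inj₁ 0≤x = *-nonneg 0≤x 0≤x
  ... | inj₂ x≤0 = ≤-trans (*-nonneg 0≤-x 0≤-x)
                     (≤-reflexive (solve 1 (λ x → (:- x) :* (:- x) := x :* x) refl x))
    where
    0≤-x : 0# ≤ - x
    0≤-x = ≤-trans (≤⇒0≤ x≤0) (≤-reflexive (+-identityˡ _))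

  0≤1 : 0# ≤ 1#
  0≤1 = ≤-trans (square-nonneg 1#) (≤-reflexive (*-identityˡ 1#))

  0<1 : 0# < 1#
  0<1 = ≤∧≉⇒< 0≤1 (0≉1 ∘ sym)

  +-pos : ∀ {x y} → 0# < x → 0# ≤ y → 0# < x + y
  +-pos {x} {y} 0<x 0≤y x+y≤0 = 0<x (0≤⇒≤ (+-nonneg (≤⇒0≤ x+y≤0) 0≤y)
    (solve 2 (λ x y → :0 :- x := (:0 :- (x :+ y)) :+ y) refl x y))

  zero-product : ∀ {x y} → ¬ (x ≈ 0#) → x * y ≈ 0# → y ≈ 0#
  zero-product {x} {y} x≉0 xy≈0 with inverse x x≉0
  ... | x⁻¹ , xx⁻¹≈1 = begin
    y                ≈⟨ *-identityˡ y ⟨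
    1# * y           ≈⟨ *-congʳ xx⁻¹≈1 ⟨
    x * x⁻¹ * y      ≈⟨ solve 3 (λ x i y → x :* i :* y := i :* (x :* y)) refl x x⁻¹ y ⟩
    x⁻¹ * (x * y)    ≈⟨ *-congˡ xy≈0 ⟩
    x⁻¹ * 0#         ≈⟨ zeroʳ _ ⟩
    0#               ∎
    where open SetoidReasoning setoid

  *-pos : ∀ {x y} → 0# < x → 0# < y → 0# < x * y
  *-pos 0<x 0<y = ≤∧≉⇒< (*-nonneg (<⇒≤ 0<x) (<⇒≤ 0<y))
    λ xy≈0 → <⇒≉ 0<y (zero-product (<⇒≉ 0<x) xy≈0)

  ⊓-pos : ∀ {x y} → 0# < x → 0# < y → 0# < x ⊓ y
  ⊓-pos {x} {y} 0<x 0<y with ⊓-sel x y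
  ... | inj₁ ≈x = <-respʳ-≈ (sym ≈x) 0<x
  ... | inj₂ ≈y = <-respʳ-≈ (sym ≈y) 0<y

  square-zero : ∀ {x} → x * x ≈ 0# → x ≈ 0#
  square-zero {x} xx≈0 with x ≟ 0#
  ... | yes x≈0 = x≈0
  ... | no x≉0  = zero-product x≉0 xx≈0

  ∣∣-nonneg : ∀ {x} → 0# ≤ x → ∣ x ∣ ≈ x
  ∣∣-nonneg {x} 0≤x with 0# ≤? x
  ... | yes _   = refl
  ... | no  0≰x = contradiction 0≤x 0≰x

  ∣∣-nonpos : ∀ {x} → x ≤ 0# → ∣ x ∣ ≈ - x
  ∣∣-nonpos {x} x≤0 with 0# ≤? x
  ... | no _    = refl
  ... | yes 0≤x = begin
    x      ≈⟨ antisym x≤0 0≤x ⟩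
    0#     ≈⟨ -0#≈0# ⟨
    - 0#   ≈⟨ -‿cong (antisym x≤0 0≤x) ⟨
    - x    ∎
    where open SetoidReasoning setoid

  -- The fields `rise` and `fall` are the two halves of a bound on the absolute value of
  -- `f y - f x`; with `x ≤ y` fixed, no absolute value occurs.
  record Lipschitz (f : Carrier → Carrier) : Set (c ⊔ ℓ) where
    field
      L     : Carrier
      0≤L   : 0# ≤ L
      rise  : ∀ {x y} → 0# ≤ x → x ≤ y → y ≤ 1# → f y ≤ f x + L * (y - x)
      fall  : ∀ {x y} → 0# ≤ x → x ≤ y → y ≤ 1# → f x ≤ f y + L * (y - x)

  record Bounded (f : Carrier → Carrier) : Set (c ⊔ ℓ) where
    field
      B     : Carrier
      0≤B   : 0# ≤ B
      upper : ∀ {x} → 0# ≤ x → x ≤ 1# → f x ≤ B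
      lower : ∀ {x} → 0# ≤ x → x ≤ 1# → - B ≤ f x

  -- The sum of the constants stands in for their maximum, since both are nonnegative.
  ⊓-lipschitz : ∀ {f g} → Lipschitz f → Lipschitz g → Lipschitz λ x → f x ⊓ g x
  ⊓-lipschitz {f} {g} lip-f lip-g = record
    { L    = F.L + G.L
    ; 0≤L  = +-nonneg F.0≤L G.0≤L
    ; rise = λ 0≤x x≤y y≤1 →
        shift (≤⇒0≤ x≤y) (F.rise 0≤x x≤y y≤1) (G.rise 0≤x x≤y y≤1)
    ; fall = λ 0≤x x≤y y≤1 →
        shift (≤⇒0≤ x≤y) (F.fall 0≤x x≤y y≤1) (G.fall 0≤x x≤y y≤1)
    }
    where
    module F = Lipschitz lip-f
    module G = Lipschitz lip-g
    L = F.L + G.L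

    shift : ∀ {a b a′ b′ d} → 0# ≤ d → a ≤ a′ + F.L * d → b ≤ b′ + G.L * d →
            a ⊓ b ≤ a′ ⊓ b′ + L * d
    shift {a} {b} {a′} {b′} {d} 0≤d a≤ b≤ = 0≤⇒≤ (≤⇒0≤ (⊓-glb
      (0≤⇒≤ (+-nonneg (+-nonneg (≤⇒0≤ a≤) (*-nonneg G.0≤L 0≤d)) (≤⇒0≤ (x⊓y≤x a b)))
        (solve 6 (λ m a a′ l l′ d → a′ :- (m :- (l :+ l′) :* d) :=
            (a′ :+ l :* d) :- a :+ l′ :* d :+ (a :- m))
          refl (a ⊓ b) a a′ F.L G.L d))
      (0≤⇒≤ (+-nonneg (+-nonneg (≤⇒0≤ b≤) (*-nonneg F.0≤L 0≤d)) (≤⇒0≤ (x⊓y≤y a b)))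
        (solve 6 (λ m b b′ l l′ d → b′ :- (m :- (l :+ l′) :* d) :=
            (b′ :+ l′ :* d) :- b :+ l :* d :+ (b :- m))
          refl (a ⊓ b) b b′ F.L G.L d))))
      (solve 3 (λ m m′ e → m′ :+ e :- m := m′ :- (m :- e)) refl (a ⊓ b) (a′ ⊓ b′) (L * d))

  module Combination {f g : Carrier → Carrier}
    (lip-f : Lipschitz f) (bd-f : Bounded f) (lip-g : Lipschitz g) (bd-g : Bounded g) where
    private
      module F = Lipschitz lip-f
      module G = Lipschitz lip-g
      module BF = Bounded bd-f
      module BG = Bounded bd-g

    -- This is the shape of the recursions for the real and imaginary parts of the powers of
    -- `1 + i t`. The product is handled by `y g(y) - x g(x) = y (g(y) - g(x)) + (y - x)
    -- g(x)`, where `y ≤ 1` and the bound on `g` come in.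
    f+xg-lipschitz : Lipschitz λ x → f x + x * g x
    f+xg-lipschitz = record
      { L    = F.L + G.L + BG.B
      ; 0≤L  = +-nonneg (+-nonneg F.0≤L G.0≤L) BG.0≤B
      ; rise = λ {x} {y} 0≤x x≤y y≤1 → 0≤⇒≤
          (+-nonneg (+-nonneg (+-nonneg
            (≤⇒0≤ (F.rise 0≤x x≤y y≤1))
            (*-nonneg (≤-trans 0≤x x≤y) (≤⇒0≤ (G.rise 0≤x x≤y y≤1))))
            (*-nonneg (≤⇒0≤ y≤1) (*-nonneg G.0≤L (≤⇒0≤ x≤y))))
            (*-nonneg (≤⇒0≤ x≤y) (≤⇒0≤ (BG.upper 0≤x (≤-trans x≤y y≤1)))))
          (solve 9 (λ x y fx fy gx gy l l′ b →
              (fx :+ x :* gx) :+ (l :+ l′ :+ b) :* (y :- x) :- (fy :+ y :* gy) :=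
              (fx :+ l :* (y :- x) :- fy) :+ y :* (gx :+ l′ :* (y :- x) :- gy) :+
              (:1 :- y) :* (l′ :* (y :- x)) :+ (y :- x) :* (b :- gx))
            refl x y (f x) (f y) (g x) (g y) F.L G.L BG.B)
      ; fall = λ {x} {y} 0≤x x≤y y≤1 → 0≤⇒≤
          (+-nonneg (+-nonneg (+-nonneg
            (≤⇒0≤ (F.fall 0≤x x≤y y≤1))
            (*-nonneg (≤-trans 0≤x x≤y) (≤⇒0≤ (G.fall 0≤x x≤y y≤1))))
            (*-nonneg (≤⇒0≤ y≤1) (*-nonneg G.0≤L (≤⇒0≤ x≤y))))
            (*-nonneg (≤⇒0≤ x≤y) (≤⇒0≤ (BG.lower 0≤x (≤-trans x≤y y≤1)))))
          (solve 9 (λ x y fx fy gx gy l l′ b →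
              (fy :+ y :* gy) :+ (l :+ l′ :+ b) :* (y :- x) :- (fx :+ x :* gx) :=
              (fy :+ l :* (y :- x) :- fx) :+ y :* (gy :+ l′ :* (y :- x) :- gx) :+
              (:1 :- y) :* (l′ :* (y :- x)) :+ (y :- x) :* (gx :- (:- b)))
            refl x y (f x) (f y) (g x) (g y) F.L G.L BG.B)
      }

    f+xg-bounded : Bounded λ x → f x + x * g x
    f+xg-bounded = record
      { B     = BF.B + BG.B
      ; 0≤B   = +-nonneg BF.0≤B BG.0≤B
      ; upper = λ {x} 0≤x x≤1 → 0≤⇒≤
          (+-nonneg (+-nonneg (≤⇒0≤ (BF.upper 0≤x x≤1))
            (*-nonneg 0≤x (≤⇒0≤ (BG.upper 0≤x x≤1)))) (*-nonneg (≤⇒0≤ x≤1) BG.0≤B))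
          (solve 5 (λ x f g a b → a :+ b :- (f :+ x :* g) :=
              (a :- f) :+ x :* (b :- g) :+ (:1 :- x) :* b)
            refl x (f x) (g x) BF.B BG.B)
      ; lower = λ {x} 0≤x x≤1 → 0≤⇒≤
          (+-nonneg (+-nonneg (≤⇒0≤ (BF.lower 0≤x x≤1))
            (*-nonneg 0≤x (≤⇒0≤ (BG.lower 0≤x x≤1)))) (*-nonneg (≤⇒0≤ x≤1) BG.0≤B))
          (solve 5 (λ x f g a b → (f :+ x :* g) :- (:- (a :+ b)) :=
              (f :- (:- a)) :+ x :* (g :- (:- b)) :+ (:1 :- x) :* b)
            refl x (f x) (g x) BF.B BG.B)
      }

  module _ {f g : Carrier → Carrier} (g≈-f : ∀ x → g x ≈ - f x) where

    neg-lipschitz : Lipschitz f → Lipschitz g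
    neg-lipschitz lip = record
      { L    = L
      ; 0≤L  = 0≤L
      ; rise = λ {x} {y} 0≤x x≤y y≤1 → 0≤⇒≤ (≤⇒0≤ (fall 0≤x x≤y y≤1)) (identity x y (L * (y - x)))
      ; fall = λ {x} {y} 0≤x x≤y y≤1 → 0≤⇒≤ (≤⇒0≤ (rise 0≤x x≤y y≤1)) (identity y x (L * (y - x)))
      }
      where
      open Lipschitz lip
      identity : ∀ x y e → g x + e - g y ≈ f y + e - f x
      identity x y e = trans (+-cong (+-congʳ (g≈-f x)) (-‿cong (g≈-f y)))
        (solve 3 (λ a b e → (:- a) :+ e :- (:- b) := b :+ e :- a) refl (f x) (f y) e)

    neg-bounded : Bounded f → Bounded g
    neg-bounded bd = record
      { B     = B
      ; 0≤B   = 0≤B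
      ; upper = λ {x} 0≤x x≤1 → 0≤⇒≤ (≤⇒0≤ (lower 0≤x x≤1))
          (trans (+-congˡ (-‿cong (g≈-f x))) (solve 2 (λ b a → b :- (:- a) := a :- (:- b)) refl B (f x)))
      ; lower = λ {x} 0≤x x≤1 → 0≤⇒≤ (≤⇒0≤ (upper 0≤x x≤1))
          (trans (+-congʳ (g≈-f x)) (solve 2 (λ b a → (:- a) :- (:- b) := b :- a) refl B (f x)))
      }
      where open Bounded bd

  -- `neg-lipschitz` accepts any function that is pointwise `- f`, so negating twice transports
  -- along a pointwise equality.
  lipschitz-cong : ∀ {f g} → (∀ x → f x ≈ g x) → Lipschitz f → Lipschitz g
  lipschitz-cong f≈g lip = neg-lipschitz (λ x → trans (sym (f≈g x)) (sym (-‿involutive _)))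
    (neg-lipschitz (λ _ → refl) lip)

  bounded-cong : ∀ {f g} → (∀ x → f x ≈ g x) → Bounded f → Bounded g
  bounded-cong f≈g bd = neg-bounded (λ x → trans (sym (f≈g x)) (sym (-‿involutive _)))
    (neg-bounded (λ _ → refl) bd)

  const-lipschitz : ∀ {f a} → (∀ x → f x ≈ a) → Lipschitz f
  const-lipschitz {f} {a} f≈a = record
    { L    = 0#
    ; 0≤L  = ≤-refl
    ; rise = λ {x} {y} _ _ _ → ≤-reflexive (constant y x (y - x))
    ; fall = λ {x} {y} _ _ _ → ≤-reflexive (constant x y (y - x))
    }
    where
    constant : ∀ x y e → f x ≈ f y + 0# * e
    constant x y e = trans (f≈a x) (trans
      (solve 2 (λ a e → a := a :+ :0 :* e) refl a e) (+-congʳ (sym (f≈a y))))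

  const-bounded : ∀ {f a} → (∀ x → f x ≈ a) → 0# ≤ a → Bounded f
  const-bounded {f} {a} f≈a 0≤a = record
    { B     = a
    ; 0≤B   = 0≤a
    ; upper = λ _ _ → ≤-reflexive (f≈a _)
    ; lower = λ {x} _ _ → 0≤⇒≤ (+-nonneg 0≤a 0≤a)
        (trans (+-congʳ (f≈a x)) (solve 1 (λ a → a :- (:- a) := a :+ a) refl a))
    }

  -- The witness is `δ = e / (1 + L)`. A step of length `δ` changes a function with constant `L` by
  -- at most `L * δ`, which leaves a margin `δ` out of `e`.
  split : ∀ {L e} → 0# ≤ L → 0# < e → ∃[ δ ] 0# < δ × L * δ + δ ≈ e
  split {L} {e} 0≤L 0<e with inverse (1# + L) (<⇒≉ (+-pos 0<1 0≤L))
  ... | i , inv = e * i , *-pos 0<e 0<i , (begin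
    L * (e * i) + e * i    ≈⟨ solve 3 (λ l e i → l :* (e :* i) :+ e :* i := e :* ((:1 :+ l) :* i)) refl L e i ⟩
    e * ((1# + L) * i)     ≈⟨ *-congˡ inv ⟩
    e * 1#                 ≈⟨ *-identityʳ e ⟩
    e                      ∎)
    where
    open SetoidReasoning setoid
    0<i : 0# < i
    0<i i≤0 = 0<1 (0≤⇒≤ (*-nonneg (+-nonneg 0≤1 0≤L) (≤⇒0≤ i≤0))
      (trans (+-congˡ (-‿cong (sym inv)))
        (solve 2 (λ l i → :0 :- (:1 :+ l) :* i := (:1 :+ l) :* (:0 :- i)) refl L i)))

  -- The zero is the supremum of the points of `[0, 1]` where `f` is nonnegative. A negative value
  -- there would make `s - δ` a smaller upper bound; a positive one would put `s + δ` into the set.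
  intermediate-value : ∀ {f} → Lipschitz f → 0# ≤ f 0# → f 1# ≤ 0# →
                       ∃[ s ] 0# ≤ s × s ≤ 1# × f s ≈ 0#
  intermediate-value {f} lip 0≤f0 f1≤0 = s , 0≤s , s≤1 , antisym fs≤0 0≤fs
    where
    open Lipschitz lip

    P : Carrier → Set (c ⊔ ℓ)
    P x = Lift c (0# ≤ x × x ≤ 1# × 0# ≤ f x)

    sup = supremum P (0# , lift (≤-refl , 0≤1 , 0≤f0)) (1# , λ x Px → proj₁ (proj₂ (Lift.lower Px)))
    s = proj₁ sup
    s-upper = proj₁ (proj₂ sup)
    s-least = proj₂ (proj₂ sup)

    0≤s : 0# ≤ s
    0≤s = s-upper 0# (lift (≤-refl , 0≤1 , 0≤f0))

    s≤1 : s ≤ 1#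
    s≤1 = s-least 1# λ x Px → proj₁ (proj₂ (Lift.lower Px))

    0≤fs : 0# ≤ f s
    0≤fs = ≮⇒≥ λ fs<0 → let
        (δ , 0<δ , Lδ+δ≈) = split {e = 0# - f s} 0≤L λ 0-fs≤0 → fs<0
          (0≤⇒≤ (≤⇒0≤ 0-fs≤0) (solve 1 (λ a → a :- :0 := :0 :- (:0 :- a)) refl (f s)))
        below : ∀ x → P x → x ≤ s - δ
        -- If `s - δ < x`, then `f x ≤ f s + L * δ`, which is `- δ`, against `0# ≤ f x`.
        below x Px = let (0≤x , x≤1 , 0≤fx) = Lift.lower Px in ≮⇒≥ λ s-δ<x →
          0<δ (0≤⇒≤ (+-nonneg (+-nonneg 0≤fx (≤⇒0≤ (fall 0≤x (s-upper x Px) s≤1)))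
                               (*-nonneg 0≤L (≤⇒0≤ (<⇒≤ s-δ<x))))
            (begin
              0# - δ
                ≈⟨ solve 3 (λ d l a → :0 :- d := l :* d :- (l :* d :+ d)) refl δ L (f s) ⟩
              L * δ - (L * δ + δ)
                ≈⟨ +-congˡ (-‿cong Lδ+δ≈) ⟩
              L * δ - (0# - f s)
                ≈⟨ solve 6 (λ d l a b s x → l :* d :- (:0 :- a) :=
                     b :+ (a :+ l :* (s :- x) :- b) :+ l :* (x :- (s :- d)))
                     refl δ L (f s) (f x) s x ⟩
              f x + (f s + L * (s - x) - f x) + L * (x - (s - δ)) ∎))
      in 0<δ (0≤⇒≤ (≤⇒0≤ (s-least (s - δ) below))
           (solve 2 (λ d s → :0 :- d := s :- d :- s) refl δ s))
      where open SetoidReasoning setoid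

    fs≤0 : f s ≤ 0#
    fs≤0 = ≮⇒≥ λ 0<fs → let
        (δ′ , 0<δ′ , Lδ′+δ′≈) = split 0≤L 0<fs
        -- At `s ≈ 1#` the positive value would meet `f 1# ≤ 0#`. The Lipschitz bound over a
        -- distance equal to zero plays the part of congruence of `f`.
        s<1 : s < 1#
        s<1 1≤s = 0<fs (≤-trans (fall 0≤s s≤1 ≤-refl) (≤-trans
          (≤-reflexive (trans
            (+-congˡ (*-congˡ (trans (+-congˡ (-‿cong (antisym s≤1 1≤s))) (-‿inverseʳ 1#))))
            (solve 2 (λ a l → a :+ l :* :0 := a) refl (f 1#) L)))
          f1≤0))
        -- The minimum keeps `s + δ` inside the interval on which the Lipschitz bound holds.
        δ = δ′ ⊓ (1# - s)
        δ≤δ′ = x⊓y≤x δ′ (1# - s)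
        δ≤1-s = x⊓y≤y δ′ (1# - s)
        0<δ : 0# < δ
        0<δ = ⊓-pos 0<δ′ λ 1-s≤0 → s<1 (0≤⇒≤ (≤⇒0≤ 1-s≤0)
          (solve 1 (λ s → s :- :1 := :0 :- (:1 :- s)) refl s))
        s≤s+δ : s ≤ s + δ
        s≤s+δ = 0≤⇒≤ (<⇒≤ 0<δ) (solve 2 (λ s d → s :+ d :- s := d) refl s δ)
        s+δ≤1 : s + δ ≤ 1#
        s+δ≤1 = 0≤⇒≤ (≤⇒0≤ δ≤1-s) (solve 2 (λ s d → :1 :- (s :+ d) := :1 :- s :- d) refl s δ)
        0≤f : 0# ≤ f (s + δ)
        0≤f = 0≤⇒≤ (+-nonneg (+-nonneg (≤⇒0≤ (fall 0≤s s≤s+δ s+δ≤1))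
                                 (*-nonneg 0≤L (≤⇒0≤ δ≤δ′))) (<⇒≤ 0<δ′))
          (begin
            f (s + δ) - 0#
              ≈⟨ solve 6 (λ a b l s d d′ → b :- :0 :=
                   (b :+ l :* (s :+ d :- s) :- a) :+ l :* (d′ :- d) :+ (a :- l :* d′))
                   refl (f s) (f (s + δ)) L s δ δ′ ⟩
            f (s + δ) + L * (s + δ - s) - f s + L * (δ′ - δ) + (f s - L * δ′)
              ≈⟨ +-congˡ (+-congʳ (sym Lδ′+δ′≈)) ⟩
            f (s + δ) + L * (s + δ - s) - f s + L * (δ′ - δ) + (L * δ′ + δ′ - L * δ′)
              ≈⟨ +-congˡ (xyx⁻¹≈y _ _) ⟩
            f (s + δ) + L * (s + δ - s) - f s + L * (δ′ - δ) + δ′ ∎)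
      in 0<δ (0≤⇒≤ (≤⇒0≤ (s-upper (s + δ) (lift (≤-trans 0≤s s≤s+δ , s+δ≤1 , 0≤f))))
           (solve 2 (λ s d → :0 :- d := s :- (s :+ d)) refl s δ))
      where open SetoidReasoning setoid

-- Complex numbers, conjugation and the norm.

module ComplexNumbers {c ℓ} (F : CompleteOrderedField c ℓ) where
  module ℝ = OrderedField F
  open ℝ using (solve; _:=_; _:+_; _:*_; _:-_; :-_; :0; :1)
  open Complex F public

  ℂ-commutativeRing : CommutativeRing c ℓ
  ℂ-commutativeRing = record
    { RawRing ℂ-rawRing
    ; isCommutativeRing = record
      { isRing = record
        { +-isAbelianGroup = record
          { isGroup = record
            { isMonoid = record
              { isSemigroup = record
                { isMagma = record
                  { isEquivalence = record
                    { refl  = ℝ.refl , ℝ.refl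
                    ; sym   = λ (p , q) → ℝ.sym p , ℝ.sym q
                    ; trans = λ (p , q) (p′ , q′) → ℝ.trans p p′ , ℝ.trans q q′
                    }
                  ; ∙-cong = λ (p , q) (p′ , q′) → ℝ.+-cong p p′ , ℝ.+-cong q q′
                  }
                ; assoc = λ _ _ _ → ℝ.+-assoc _ _ _ , ℝ.+-assoc _ _ _
                }
              ; identity = (λ _ → ℝ.+-identityˡ _ , ℝ.+-identityˡ _) ,
                           (λ _ → ℝ.+-identityʳ _ , ℝ.+-identityʳ _)
              }
            ; inverse = (λ _ → ℝ.-‿inverseˡ _ , ℝ.-‿inverseˡ _) ,
                        (λ _ → ℝ.-‿inverseʳ _ , ℝ.-‿inverseʳ _)
            ; ⁻¹-cong = λ (p , q) → ℝ.-‿cong p , ℝ.-‿cong q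
            }
          ; comm = λ _ _ → ℝ.+-comm _ _ , ℝ.+-comm _ _
          }
        ; *-cong = λ (p , q) (p′ , q′) →
            ℝ.+-cong (ℝ.*-cong p p′) (ℝ.-‿cong (ℝ.*-cong q q′)) ,
            ℝ.+-cong (ℝ.*-cong p q′) (ℝ.*-cong q p′)
        ; *-assoc = λ (a +i b) (c +i d) (e +i f) →
            solve 6 (λ a b c d e f →
              (a :* c :- b :* d) :* e :- (a :* d :+ b :* c) :* f :=
              a :* (c :* e :- d :* f) :- b :* (c :* f :+ d :* e)) ℝ.refl a b c d e f ,
            solve 6 (λ a b c d e f →
              (a :* c :- b :* d) :* f :+ (a :* d :+ b :* c) :* e :=
              a :* (c :* f :+ d :* e) :+ b :* (c :* e :- d :* f)) ℝ.refl a b c d e f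
        ; *-identity =
            (λ (a +i b) →
              solve 2 (λ a b → :1 :* a :- :0 :* b := a) ℝ.refl a b ,
              solve 2 (λ a b → :1 :* b :+ :0 :* a := b) ℝ.refl a b) ,
            (λ (a +i b) →
              solve 2 (λ a b → a :* :1 :- b :* :0 := a) ℝ.refl a b ,
              solve 2 (λ a b → a :* :0 :+ b :* :1 := b) ℝ.refl a b)
        ; distrib =
            (λ (a +i b) (c +i d) (e +i f) →
              solve 6 (λ a b c d e f → a :* (c :+ e) :- b :* (d :+ f) :=
                (a :* c :- b :* d) :+ (a :* e :- b :* f)) ℝ.refl a b c d e f ,
              solve 6 (λ a b c d e f → a :* (d :+ f) :+ b :* (c :+ e) :=
                (a :* d :+ b :* c) :+ (a :* f :+ b :* e)) ℝ.refl a b c d e f) ,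
            (λ (a +i b) (c +i d) (e +i f) →
              solve 6 (λ a b c d e f → (c :+ e) :* a :- (d :+ f) :* b :=
                (c :* a :- d :* b) :+ (e :* a :- f :* b)) ℝ.refl a b c d e f ,
              solve 6 (λ a b c d e f → (c :+ e) :* b :+ (d :+ f) :* a :=
                (c :* b :+ d :* a) :+ (e :* b :+ f :* a)) ℝ.refl a b c d e f)
        }
      ; *-comm = λ (a +i b) (c +i d) →
          solve 4 (λ a b c d → a :* c :- b :* d := c :* a :- d :* b) ℝ.refl a b c d ,
          solve 4 (λ a b c d → a :* d :+ b :* c := c :* b :+ d :* a) ℝ.refl a b c d
      }
    }

  open CommutativeRing ℂ-commutativeRing public hiding (zero)
  open RingProperties ring public
  open Powers semiring public using (_^_; ^-congˡ; ^-homo-*; ^-assocʳ)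
  open CommutativePowers commutativeSemiring public using (^-distrib-*)
  open SetoidReasoning setoid

  1#^ : ∀ k → 1# ^ k ≈ 1#
  1#^ zero    = refl
  1#^ (suc k) = trans (*-identityˡ _) (1#^ k)

  conj : ℂ → ℂ
  conj z = re z +i (ℝ.- im z)

  conj-* : ∀ z w → conj (z * w) ≈ conj z * conj w
  conj-* (a +i b) (c +i d) =
    solve 4 (λ a b c d → a :* c :- b :* d := a :* c :- (:- b) :* (:- d)) ℝ.refl a b c d ,
    solve 4 (λ a b c d → :- (a :* d :+ b :* c) := a :* (:- d) :+ (:- b) :* c) ℝ.refl a b c d

  conj-cong : ∀ {z w} → z ≈ w → conj z ≈ conj w
  conj-cong (p , q) = p , ℝ.-‿cong q

  conj-^ : ∀ z k → conj (z ^ k) ≈ conj z ^ k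
  conj-^ z zero    = ℝ.refl , ℝ.-0#≈0#
  conj-^ z (suc k) = trans (conj-* z (z ^ k)) (*-congˡ {conj z} (conj-^ z k))

  -- The squared modulus: it is polynomial in the two parts, and equal to one exactly on the unit
  -- circle.
  norm : ℂ → ℝ.Carrier
  norm z = re z ℝ.* re z ℝ.+ im z ℝ.* im z

  norm-cong : ∀ {z w} → z ≈ w → norm z ℝ.≈ norm w
  norm-cong (p , q) = ℝ.+-cong (ℝ.*-cong p p) (ℝ.*-cong q q)

  norm-* : ∀ z w → norm (z * w) ℝ.≈ norm z ℝ.* norm w
  norm-* (a +i b) (c +i d) = solve 4 (λ a b c d →
      (a :* c :- b :* d) :* (a :* c :- b :* d) :+ (a :* d :+ b :* c) :* (a :* d :+ b :* c) :=
      (a :* a :+ b :* b) :* (c :* c :+ d :* d)) ℝ.refl a b c d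

  norm-1# : norm 1# ℝ.≈ ℝ.1#
  norm-1# = solve 0 (:1 :* :1 :+ :0 :* :0 := :1) ℝ.refl

  norm-unit-* : ∀ {z w} → norm z ℝ.≈ ℝ.1# → norm w ℝ.≈ ℝ.1# → norm (z * w) ℝ.≈ ℝ.1#
  norm-unit-* {z} {w} |z|≈1 |w|≈1 =
    ℝ.trans (norm-* z w) (ℝ.trans (ℝ.*-cong |z|≈1 |w|≈1) (ℝ.*-identityˡ ℝ.1#))

  norm-unit-^ : ∀ {z} → norm z ℝ.≈ ℝ.1# → ∀ k → norm (z ^ k) ℝ.≈ ℝ.1#
  norm-unit-^     |z|≈1 zero    = norm-1#
  norm-unit-^ {z} |z|≈1 (suc k) = norm-unit-* {z} {z ^ k} |z|≈1 (norm-unit-^ |z|≈1 k)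

  *-conj : ∀ z → z * conj z ≈ norm z +i ℝ.0#
  *-conj (a +i b) =
    solve 2 (λ a b → a :* a :- b :* (:- b) := a :* a :+ b :* b) ℝ.refl a b ,
    solve 2 (λ a b → a :* (:- b) :+ b :* a := :0) ℝ.refl a b

  unit-conj : ∀ {z} → norm z ℝ.≈ ℝ.1# → z * conj z ≈ 1#
  unit-conj {z} |z|≈1 = trans (*-conj z) (|z|≈1 , ℝ.refl)

  norm≈0⇒re≈0 : ∀ {z} → norm z ℝ.≈ ℝ.0# → re z ℝ.≈ ℝ.0#
  norm≈0⇒re≈0 {a +i b} |z|≈0 = ℝ.square-zero (ℝ.antisym
    (ℝ.0≤⇒≤ (ℝ.square-nonneg b) (ℝ.trans (ℝ.+-congʳ (ℝ.sym |z|≈0))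
      (solve 2 (λ a b → (a :* a :+ b :* b) :- a :* a := b :* b) ℝ.refl a b)))
    (ℝ.square-nonneg a))

  norm≈0⇒≈0 : ∀ {z} → norm z ℝ.≈ ℝ.0# → z ≈ 0#
  norm≈0⇒≈0 {z} |z|≈0 = norm≈0⇒re≈0 {z} |z|≈0 ,
    norm≈0⇒re≈0 {im z +i re z} (ℝ.trans (ℝ.+-comm _ _) |z|≈0)

  -- The norm is multiplicative and vanishes only at zero, which moves the question to `ℝ`.
  *-zero-cancelˡ : ∀ {z w} → ¬ (z ≈ 0#) → z * w ≈ 0# → w ≈ 0#
  *-zero-cancelˡ {z} {w} z≉0 zw≈0 = norm≈0⇒≈0 {w} (ℝ.zero-product
    (z≉0 ∘ norm≈0⇒≈0 {z})
    (ℝ.trans (ℝ.sym (norm-* z w)) (ℝ.trans (norm-cong {z * w} zw≈0)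
      (solve 0 (:0 :* :0 :+ :0 :* :0 := :0) ℝ.refl))))

  -- If `a > 1` then `(a - 1)(a + 1) + b²` is positive, yet it equals the norm minus one. The lower
  -- bound is the upper one for `- a`.
  norm≈1⇒-1≤re≤1 : ∀ {z} → norm z ℝ.≈ ℝ.1# → ℝ.- ℝ.1# ℝ.≤ re z × re z ℝ.≤ ℝ.1#
  norm≈1⇒-1≤re≤1 {a +i b} |z|≈1 = lower , bound a |z|≈1
    where

    bound : ∀ a → a ℝ.* a ℝ.+ b ℝ.* b ℝ.≈ ℝ.1# → a ℝ.≤ ℝ.1#
    bound a |z|≈1 = ℝ.≮⇒≥ λ 1<a → ℝ.+-pos
        (ℝ.*-pos {a ℝ.- ℝ.1#} {a ℝ.+ ℝ.1#} (positive 1<a)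
          (ℝ.<-respʳ-≈ (ℝ.+-comm ℝ.1# a) (ℝ.+-pos ℝ.0<1 (ℝ.≤-trans ℝ.0≤1 (ℝ.<⇒≤ 1<a)))))
        (ℝ.square-nonneg b)
        (ℝ.≤-reflexive (ℝ.trans
          (solve 2 (λ a b → (a :- :1) :* (a :+ :1) :+ b :* b := (a :* a :+ b :* b) :- :1) ℝ.refl a b)
          (ℝ.trans (ℝ.+-congʳ |z|≈1) (ℝ.-‿inverseʳ ℝ.1#))))
      where
      positive : ℝ.1# ℝ.< a → ℝ.0# ℝ.< a ℝ.- ℝ.1#
      positive 1<a a-1≤0 = 1<a (ℝ.0≤⇒≤ (ℝ.≤⇒0≤ a-1≤0)
        (solve 1 (λ a → :1 :- a := :0 :- (a :- :1)) ℝ.refl a))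

    lower : ℝ.- ℝ.1# ℝ.≤ a
    lower = ℝ.0≤⇒≤ (ℝ.≤⇒0≤ (bound (ℝ.- a) (ℝ.trans
        (solve 2 (λ a b → (:- a) :* (:- a) :+ b :* b := a :* a :+ b :* b) ℝ.refl a b) |z|≈1)))
      (solve 1 (λ a → a :- (:- :1) := :1 :- (:- a)) ℝ.refl a)

  norm-conj : ∀ z → norm (conj z) ℝ.≈ norm z
  norm-conj (a +i b) = solve 2 (λ a b → a :* a :+ (:- b) :* (:- b) := a :* a :+ b :* b) ℝ.refl a b

  real-* : ∀ a b → (a +i ℝ.0#) * (b +i ℝ.0#) ≈ (a ℝ.* b) +i ℝ.0#
  real-* a b = solve 2 (λ a b → a :* b :- :0 :* :0 := a :* b) ℝ.refl a b ,
               solve 2 (λ a b → a :* :0 :+ :0 :* b := :0) ℝ.refl a b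

  -- Comparing imaginary parts gives `4ab = 0`. The conclusion is phrased with `≤` because it is
  -- used to refute `0 < ab`.
  square≈conj-square⇒re*im≤0 : ∀ z → z * z ≈ conj z * conj z → re z ℝ.* im z ℝ.≤ ℝ.0#
  square≈conj-square⇒re*im≤0 (a +i b) (_ , im-eq) = ℝ.≮⇒≥ λ 0<ab →
    ℝ.+-pos (ℝ.+-pos 0<ab (ℝ.<⇒≤ 0<ab)) (ℝ.+-nonneg (ℝ.<⇒≤ 0<ab) (ℝ.<⇒≤ 0<ab))
      (ℝ.≤-reflexive (ℝ.trans
        (solve 2 (λ a b → a :* b :+ a :* b :+ (a :* b :+ a :* b) :=
          (a :* b :+ b :* a) :- (a :* (:- b) :+ (:- b) :* a)) ℝ.refl a b)
        (ℝ.trans (ℝ.+-congʳ im-eq) (ℝ.-‿inverseʳ _))))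

-- Powers of 1 + i t up to the first quarter turn.

module QuarterTurns {c ℓ} (F : CompleteOrderedField c ℓ) where
  open ComplexNumbers F
  open ℝ using (_<_; Lipschitz; Bounded; _⊓_; solve; _:=_; _:+_; _:*_; _:-_; :0; :1)

  w : ℝ.Carrier → ℂ
  w t = ℝ.1# +i t

  reʷ imʷ : ℕ → ℝ.Carrier → ℝ.Carrier
  reʷ k t = re (w t ^ k)
  imʷ k t = im (w t ^ k)

  reʷ-suc : ∀ k t → reʷ (suc k) t ℝ.≈ reʷ k t ℝ.+ t ℝ.* (ℝ.- imʷ k t)
  reʷ-suc k t = ℝ.+-cong (ℝ.*-identityˡ _) (ℝ.-‿distribʳ-* t (imʷ k t))

  imʷ-suc : ∀ k t → imʷ (suc k) t ℝ.≈ imʷ k t ℝ.+ t ℝ.* reʷ k t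
  imʷ-suc k t = ℝ.+-congʳ (ℝ.*-identityˡ _)

  Tame : (ℝ.Carrier → ℝ.Carrier) → Set (c ⊔ ℓ)
  Tame f = Lipschitz f × Bounded f

  tame-cong : ∀ {f g} → (∀ x → f x ℝ.≈ g x) → Tame f → Tame g
  tame-cong f≈g (lip , bd) = ℝ.lipschitz-cong f≈g lip , ℝ.bounded-cong f≈g bd

  tame-neg : ∀ {f} → Tame f → Tame λ x → ℝ.- f x
  tame-neg (lip , bd) =
    ℝ.neg-lipschitz (λ _ → ℝ.refl) lip , ℝ.neg-bounded (λ _ → ℝ.refl) bd

  tame-const : ∀ {a} → ℝ.0# ℝ.≤ a → Tame λ _ → a
  tame-const 0≤a =
    ℝ.const-lipschitz (λ _ → ℝ.refl) , ℝ.const-bounded (λ _ → ℝ.refl) 0≤a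

  tame-f+xg : ∀ {f g} → Tame f → Tame g → Tame λ x → f x ℝ.+ x ℝ.* g x
  tame-f+xg (lip-f , bd-f) (lip-g , bd-g) = f+xg-lipschitz , f+xg-bounded
    where open ℝ.Combination lip-f bd-f lip-g bd-g

  tame-reʷ-imʷ : ∀ k → Tame (reʷ k) × Tame (imʷ k)
  tame-reʷ-imʷ zero    = tame-const ℝ.0≤1 , tame-const ℝ.≤-refl
  tame-reʷ-imʷ (suc k) with tame-reʷ-imʷ k
  ... | tame-re , tame-im =
    tame-cong (λ t → ℝ.sym (reʷ-suc k t)) (tame-f+xg tame-re (tame-neg tame-im)) ,
    tame-cong (λ t → ℝ.sym (imʷ-suc k t)) (tame-f+xg tame-im tame-re)

  minReʷ : ℕ → ℝ.Carrier → ℝ.Carrier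
  minReʷ zero    t = reʷ 0 t
  minReʷ (suc n) t = minReʷ n t ⊓ reʷ (suc n) t

  minReʷ-lipschitz : ∀ n → Lipschitz (minReʷ n)
  minReʷ-lipschitz zero    = proj₁ (proj₁ (tame-reʷ-imʷ 0))
  minReʷ-lipschitz (suc n) =
    ℝ.⊓-lipschitz (minReʷ-lipschitz n) (proj₁ (proj₁ (tame-reʷ-imʷ (suc n))))

  minReʷ-≤ : ∀ {k n} → k ℕ.≤ n → ∀ t → minReʷ n t ℝ.≤ reʷ k t
  minReʷ-≤ {k} {n} k≤n t with ℕ.≤⇒≤′ k≤n
  ... | ℕ.≤′-reflexive ≡.refl = last k
    where
    last : ∀ k → minReʷ k t ℝ.≤ reʷ k t
    last zero    = ℝ.≤-refl
    last (suc k) = ℝ.x⊓y≤y _ _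
  ... | ℕ.≤′-step k≤′n = ℝ.≤-trans (ℝ.x⊓y≤x _ _) (minReʷ-≤ (ℕ.≤′⇒≤ k≤′n) t)

  minReʷ-attained : ∀ n t → ∃[ k ] k ℕ.≤ n × minReʷ n t ℝ.≈ reʷ k t
  minReʷ-attained zero    t = 0 , z≤n , ℝ.refl
  minReʷ-attained (suc n) t with ℝ.⊓-sel (minReʷ n t) (reʷ (suc n) t)
  ... | inj₂ ≈re  = suc n , ℕ.≤-refl , ≈re
  ... | inj₁ ≈min with minReʷ-attained n t
  ...   | k , k≤n , ≈re = k , ℕ.m≤n⇒m≤1+n k≤n , ℝ.trans ≈min ≈re

  t≈0⇒reʷ≈1 : ∀ {t} → t ℝ.≈ ℝ.0# → ∀ k → reʷ k t ℝ.≈ ℝ.1#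
  t≈0⇒reʷ≈1 t≈0 k = proj₁ (trans (^-congˡ k (ℝ.refl , t≈0)) (1#^ k))

  -- An angle-free way to say that `w t` has argument `π / 2n`: the powers strictly between 0 and
  -- `n` lie in the open first quadrant, and the `n`-th on the positive imaginary axis.
  record QuarterTurn (n : ℕ) : Set (c ⊔ ℓ) where
    field
      t      : ℝ.Carrier
      re-pos : ∀ k → k ℕ.< n → ℝ.0# < reʷ k t
      im-pos : ∀ k → 0 ℕ.< k → k ℕ.≤ n → ℝ.0# < imʷ k t
      re≈0   : reʷ n t ℝ.≈ ℝ.0#

  -- All real parts are 1 at `t = 0`, and the square has real part 0 at `t = 1`, which is where
  -- `2 ≤ n` enters. It is not known beforehand which index attains the zero minimum; the signs of
  -- the imaginary parts exclude every index below `n`.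
  quarterTurn : ∀ n → 2 ℕ.≤ n → QuarterTurn n
  quarterTurn n 2≤n = record
    { t      = s
    ; re-pos = λ k k<n → ℝ.≤∧≉⇒< (re-nonneg k (ℕ.<⇒≤ k<n)) (re≉0 k k<n)
    ; im-pos = im-pos
    ; re≈0   = re≈0
    }
    where
    minReʷ-0 : ℝ.0# ℝ.≤ minReʷ n ℝ.0#
    minReʷ-0 with minReʷ-attained n ℝ.0#
    ... | k , _ , ≈re = ℝ.≤-trans ℝ.0≤1
      (ℝ.≤-reflexive (ℝ.sym (ℝ.trans ≈re (t≈0⇒reʷ≈1 ℝ.refl k))))

    -- (1 + i)² = 2i
    minReʷ-1 : minReʷ n ℝ.1# ℝ.≤ ℝ.0#
    minReʷ-1 = ℝ.≤-trans (minReʷ-≤ 2≤n ℝ.1#) (ℝ.≤-reflexive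
      (solve 0 (:1 :* (:1 :* :1 :- :1 :* :0) :- :1 :* (:1 :* :0 :+ :1 :* :1) := :0) ℝ.refl))

    ivt = ℝ.intermediate-value (minReʷ-lipschitz n) minReʷ-0 minReʷ-1
    s = proj₁ ivt
    min≈0 = proj₂ (proj₂ (proj₂ ivt))

    re-nonneg : ∀ k → k ℕ.≤ n → ℝ.0# ℝ.≤ reʷ k s
    re-nonneg k k≤n = ℝ.≤-trans (ℝ.≤-reflexive (ℝ.sym min≈0)) (minReʷ-≤ k≤n s)

    zero-index = minReʷ-attained n s
    k₀ = proj₁ zero-index
    k₀≤n = proj₁ (proj₂ zero-index)
    re-k₀≈0 : reʷ k₀ s ℝ.≈ ℝ.0#
    re-k₀≈0 = ℝ.trans (ℝ.sym (proj₂ (proj₂ zero-index))) min≈0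

    s-pos : ℝ.0# < s
    s-pos = ℝ.≤∧≉⇒< (proj₁ (proj₂ ivt)) λ s≈0 →
      ℝ.0≉1 (ℝ.trans (ℝ.sym re-k₀≈0) (t≈0⇒reʷ≈1 s≈0 k₀))

    -- The imaginary part is `s` at index 1, and each further factor `w s` adds `s` times a
    -- nonnegative real part.
    im-pos : ∀ k → 0 ℕ.< k → k ℕ.≤ n → ℝ.0# < imʷ k s
    im-pos 1 _ _ = ℝ.<-respʳ-≈
      (ℝ.sym (ℝ.trans (imʷ-suc 0 s) (ℝ.trans (ℝ.+-identityˡ _) (ℝ.*-identityʳ s)))) s-pos
    im-pos (suc k@(suc _)) _ 1+k≤n = ℝ.<-respʳ-≈ (ℝ.sym (imʷ-suc k s))
      (ℝ.+-pos (im-pos k (s≤s z≤n) (ℕ.<⇒≤ 1+k≤n))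
               (ℝ.*-nonneg (ℝ.<⇒≤ s-pos) (re-nonneg k (ℕ.<⇒≤ 1+k≤n))))

    -- A zero real part would be followed by a negative one.
    re≉0 : ∀ k → k ℕ.< n → ¬ (reʷ k s ℝ.≈ ℝ.0#)
    re≉0 zero      _   re≈0 = ℝ.0≉1 (ℝ.sym re≈0)
    re≉0 k@(suc _) k<n re≈0 = ℝ.*-pos s-pos (im-pos k (s≤s z≤n) (ℕ.<⇒≤ k<n))
      (ℝ.0≤⇒≤ (re-nonneg (suc k) k<n) (ℝ.sym (ℝ.trans (reʷ-suc k s)
        (ℝ.+-cong re≈0 (ℝ.sym (ℝ.-‿distribʳ-* s (imʷ k s)))))))

    re≈0 : reʷ n s ℝ.≈ ℝ.0#
    re≈0 with ℕ.m≤n⇒m<n∨m≡n k₀≤n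
    ... | inj₁ k₀<n = contradiction re-k₀≈0 (re≉0 k₀ k₀<n)
    ... | inj₂ k₀≡n = ≡.subst (λ k → reʷ k s ℝ.≈ ℝ.0#) k₀≡n re-k₀≈0

-- Roots of unity.

module RootsOfUnity {c ℓ} (F : CompleteOrderedField c ℓ) where
  open ComplexNumbers F
  open QuarterTurns F
  open ℝ using (_<_)
  open IntegerSolver ℂ-commutativeRing
  open SetoidReasoning setoid

  -- One record serves both cycles: `ζ` solves the equation of the negative one, and the powers of
  -- `ζ * ζ` are the roots of that of the positive one.
  record PrimitiveRoot (n : ℕ) : Set (c ⊔ ℓ) where
    field
      ζ      : ℂ
      norm-ζ : norm ζ ℝ.≈ ℝ.1#
      ζ^n    : ζ ^ n ≈ - 1#
      ζ²^≉1  : ∀ k → 0 ℕ.< k → k ℕ.< n → ¬ ((ζ * ζ) ^ k ≈ 1#)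

  primitiveRoot : ∀ n → 2 ℕ.≤ n → PrimitiveRoot n
  primitiveRoot n 2≤n = record
    { ζ      = ζ
    ; norm-ζ = norm-ζ
    ; ζ^n    = ζ^n
    ; ζ²^≉1  = ζ²^≉1
    }
    where
    open QuarterTurn (quarterTurn n 2≤n)
    v = w t

    norm-pos : ℝ.0# < norm v
    norm-pos = ℝ.+-pos (ℝ.*-pos ℝ.0<1 ℝ.0<1) (ℝ.square-nonneg t)

    inv = ℝ.inverse (norm v) (ℝ.<⇒≉ norm-pos)
    u = proj₁ inv
    -- This is `v / conj v`, written as `v² / norm v` so that only a real number is inverted.
    ζ = v * v * (u +i ℝ.0#)

    ζ*conj : ζ * conj v ≈ v
    ζ*conj = begin
      v * v * (u +i ℝ.0#) * conj v
        ≈⟨ solve 3 (λ v u v̄ → v :* v :* u :* v̄ := v :* (v :* v̄ :* u)) refl v (u +i ℝ.0#) (conj v) ⟩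
      v * (v * conj v * (u +i ℝ.0#))
        ≈⟨ *-congˡ {v} (*-congʳ {u +i ℝ.0#} (*-conj v)) ⟩
      v * ((norm v +i ℝ.0#) * (u +i ℝ.0#))
        ≈⟨ *-congˡ {v} (trans (real-* (norm v) u) (proj₂ inv , ℝ.refl)) ⟩
      v * 1#
        ≈⟨ *-identityʳ v ⟩
      v ∎

    ζ^*conj : ∀ k → ζ ^ k * conj (v ^ k) ≈ v ^ k
    ζ^*conj k = begin
      ζ ^ k * conj (v ^ k)   ≈⟨ *-congˡ {ζ ^ k} (conj-^ v k) ⟩
      ζ ^ k * conj v ^ k     ≈⟨ ^-distrib-* ζ (conj v) k ⟨
      (ζ * conj v) ^ k       ≈⟨ ^-congˡ k ζ*conj ⟩
      v ^ k                  ∎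

    -- Take norms in `ζ * conj v ≈ v` and cancel `norm v` against its inverse `u`.
    norm-ζ : norm ζ ℝ.≈ ℝ.1#
    norm-ζ =
      ℝ.trans (ℝ.sym (ℝ.*-identityʳ _)) (
      ℝ.trans (ℝ.sym (ℝ.*-congˡ (proj₂ inv))) (
      ℝ.trans (ℝ.sym (ℝ.*-assoc _ _ _)) (
      ℝ.trans (ℝ.sym (ℝ.*-congʳ (ℝ.*-congˡ (norm-conj v)))) (
      ℝ.trans (ℝ.sym (ℝ.*-congʳ (norm-* ζ (conj v)))) (
      ℝ.trans (ℝ.*-congʳ (norm-cong {ζ * conj v} {v} ζ*conj)) (
      proj₂ inv))))))

    -- The power `v ^ n` is purely imaginary and nonzero, so its quotient by its conjugate is minus
    -- one.
    ζ^n : ζ ^ n ≈ - 1#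
    ζ^n = +-inverseˡ-unique (ζ ^ n) 1# (*-zero-cancelˡ {V̄} {ζ ^ n + 1#} V̄≉0 (begin
      V̄ * (ζ ^ n + 1#)
        ≈⟨ solve 2 (λ v̄ z → v̄ :* (z :+ :1) := z :* v̄ :+ v̄) refl V̄ (ζ ^ n) ⟩
      ζ ^ n * V̄ + V̄
        ≈⟨ +-cong {ζ ^ n * V̄} {v ^ n} (ζ^*conj n) V̄≈-V ⟩
      v ^ n - v ^ n
        ≈⟨ -‿inverseʳ (v ^ n) ⟩
      0# ∎))
      where
      V̄ = conj (v ^ n)

      V̄≈-V : V̄ ≈ - (v ^ n)
      V̄≈-V = ℝ.trans re≈0 (ℝ.trans (ℝ.sym ℝ.-0#≈0#) (ℝ.-‿cong (ℝ.sym re≈0))) , ℝ.refl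

      V̄≉0 : ¬ (V̄ ≈ 0#)
      V̄≉0 (_ , -im≈0) = ℝ.<⇒≉ (im-pos n (ℕ.<⇒≤ 2≤n) ℕ.≤-refl)
        (ℝ.-‿injective (ℝ.trans -im≈0 (ℝ.sym ℝ.-0#≈0#)))

    -- Otherwise `v ^ k` and its conjugate would have the same square, although `v ^ k` lies in the
    -- open first quadrant.
    ζ²^≉1 : ∀ k → 0 ℕ.< k → k ℕ.< n → ¬ ((ζ * ζ) ^ k ≈ 1#)
    ζ²^≉1 k 0<k k<n ζ²^≈1 = ℝ.*-pos (re-pos k k<n) (im-pos k 0<k (ℕ.<⇒≤ k<n))
      (square≈conj-square⇒re*im≤0 (v ^ k) (begin
        v ^ k * v ^ k
          ≈⟨ *-cong (ζ^*conj k) (ζ^*conj k) ⟨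
        ζ ^ k * V̄ * (ζ ^ k * V̄)
          ≈⟨ solve 2 (λ z v̄ → z :* v̄ :* (z :* v̄) := z :* z :* (v̄ :* v̄)) refl (ζ ^ k) V̄ ⟩
        ζ ^ k * ζ ^ k * (V̄ * V̄)
          ≈⟨ *-congʳ {V̄ * V̄} (trans (sym (^-distrib-* ζ ζ k)) ζ²^≈1) ⟩
        1# * (V̄ * V̄)
          ≈⟨ *-identityˡ (V̄ * V̄) ⟩
        V̄ * V̄ ∎))
      where V̄ = conj (v ^ k)

-- Sums over pairs of indices.

module PairSums {c ℓ} (R : CommutativeRing c ℓ) where
  open CommutativeRing R hiding (zero)
  open Determinant R using (sum; sum-permute; sum-cong-≋)
  open SetoidReasoning setoid

  sum-remQuot : ∀ n (f : Fin n × Fin 2 → Carrier) →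
    sum (λ k → f (remQuot {n} 2 k)) ≈ sum λ i → f (i , zero) + f (i , suc zero)
  sum-remQuot zero    f = refl
  sum-remQuot (suc n) f = trans (sym (+-assoc _ _ _))
    (+-congˡ (sum-remQuot n λ (i , b) → f (suc i , b)))

  -- The enumeration of the product graph is an arbitrary bijection, so the sum is permuted into the
  -- lexicographic order of `remQuot`.
  sum-pairs : ∀ {m n} (p : Fin m ↔ (Fin n × Fin 2)) (f : Fin n × Fin 2 → Carrier) →
    sum (λ k → f (Inverse.to p k)) ≈ sum λ i → f (i , zero) + f (i , suc zero)
  sum-pairs {m} {n} p f = begin
    sum (λ k → f (Inverse.to p k))
      ≈⟨ sum-cong-≋ (λ k → reflexive (≡.cong f (Inverse.strictlyInverseˡ Fin.*↔× (Inverse.to p k)))) ⟨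
    sum (λ k → f (remQuot {n} 2 (Inverse.to π k)))
      ≈⟨ sum-permute (λ k → f (remQuot {n} 2 k)) π ⟨
    sum (λ k → f (remQuot {n} 2 k))
      ≈⟨ sum-remQuot n f ⟩
    sum (λ i → f (i , zero) + f (i , suc zero)) ∎
    where
    π : Fin m ↔ Fin (n ℕ.* 2)
    π = ↔-sym Fin.*↔× ↔-∘ p

-- Successors and partial sign products along a cycle.

toℕ-next : ∀ {n} (i : Fin (suc n)) → toℕ (next i) ≡ suc (toℕ i) ℕ.% suc n
toℕ-next i = Fin.toℕ-fromℕ< _

next-inject₁ : ∀ {n} (i : Fin n) → next (inject₁ i) ≡ suc i
next-inject₁ {n} i = Fin.toℕ-injective (≡.trans (toℕ-next (inject₁ i))
  (≡.trans (≡.cong (λ k → suc k ℕ.% suc n) (Fin.toℕ-inject₁ i)) (ℕ.m<n⇒m%n≡m (s≤s (Fin.toℕ<n i)))))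

next-fromℕ : ∀ n → next (Fin.fromℕ n) ≡ zero
next-fromℕ n = Fin.toℕ-injective (≡.trans (toℕ-next (Fin.fromℕ n))
  (≡.trans (≡.cong (λ k → suc k ℕ.% suc n) (Fin.toℕ-fromℕ n)) (ℕ.n%n≡0 (suc n))))

partialSign : ∀ {n} → (Fin n → Sign) → Fin n → Sign
partialSign σ zero    = Sign.+
partialSign σ (suc i) = σ zero Sign.* partialSign (σ ∘ suc) i

-- The definition peels signs off the front, whereas a step along the cycle appends one at the end.
partialSign-suc : ∀ {n} (σ : Fin (suc n) → Sign) i →
  partialSign σ (suc i) ≡ partialSign σ (inject₁ i) Sign.* σ (inject₁ i)
partialSign-suc σ zero    = Sign.*-identityʳ (σ zero)
partialSign-suc σ (suc i) = ≡.trans (≡.cong (σ zero Sign.*_) (partialSign-suc (σ ∘ suc) i))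
  (≡.sym (Sign.*-assoc (σ zero) _ _))

partialSign-fromℕ : ∀ {n} (σ : Fin (suc n) → Sign) →
  partialSign σ (Fin.fromℕ n) Sign.* σ (Fin.fromℕ n) ≡ Vector.foldr Sign._*_ Sign.+ σ
partialSign-fromℕ {zero}  σ = ≡.sym (Sign.*-identityʳ (σ zero))
partialSign-fromℕ {suc n} σ = ≡.trans (Sign.*-assoc (σ zero) _ _)
  (≡.cong (σ zero Sign.*_) (partialSign-fromℕ (σ ∘ suc)))

-- Characteristic polynomial from an eigenbasis.

module Eigenbases {c ℓ} (F : CompleteOrderedField c ℓ) where
  open ComplexNumbers F
  open Determinant ℂ-commutativeRing hiding (det)
  open Spectral F using (IsSpectrum; charPoly; det)
  open IntegerSolver ℂ-commutativeRing
  open SetoidReasoning setoid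

  1≉0 : ¬ (1# ≈ 0#)
  1≉0 (1≈0 , _) = ℝ.0≉1 (ℝ.sym 1≈0)

  product : ∀ {n} → Row n → ℂ
  product = Vector.foldr _*_ 1#

  product-≈0 : ∀ {n} {d : Row n} k → d k ≈ 0# → product d ≈ 0#
  product-≈0 {d = d} zero    dₖ≈0 = trans (*-congʳ {product (d ∘ suc)} dₖ≈0) (zeroˡ (product (d ∘ suc)))
  product-≈0 {d = d} (suc k) dₖ≈0 = trans (*-congˡ {d zero} (product-≈0 k dₖ≈0)) (zeroʳ (d zero))

  product-≉0 : ∀ {n} {d : Row n} → (∀ k → ¬ (d k ≈ 0#)) → ¬ (product d ≈ 0#)
  product-≉0 {zero}      d≉0 p≈0 = 1≉0 p≈0
  product-≉0 {suc n} {d} d≉0 p≈0 = product-≉0 (λ k → d≉0 (suc k))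
    (*-zero-cancelˡ {d zero} {product (d ∘ suc)} (d≉0 zero) p≈0)

  -- The determinants of `S` and `T` multiply to the product of the `κ i`. Invertibility of a matrix
  -- of eigenvectors is thereby reduced to orthogonality relations.
  det-≉0 : ∀ {n} (S T : Rows n n) (κ : Row n) → (∀ i → (S · T) i ≋ diag κ i) →
           (∀ i → ¬ (κ i ≈ 0#)) → ¬ (det S ≈ 0#)
  det-≉0 S T κ ST≋κ κ≉0 detS≈0 = product-≉0 κ≉0 (begin
    product κ           ≈⟨ det-diag κ ⟨
    det (diag κ)        ≈⟨ det-cong ST≋κ ⟨
    det (S · T)         ≈⟨ det-· S T ⟩
    det S * det T       ≈⟨ *-congʳ {det T} detS≈0 ⟩
    0# * det T          ≈⟨ zeroˡ (det T) ⟩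
    0#                  ∎)

  module _ {n} {A S : Rows n n} {μ : Row n}
    (AS≋Sμ : ∀ i k → (A · S) i k ≈ S i k * μ k) (detS≉0 : ¬ (det S ≈ 0#)) where

    -- Take determinants in `(x I - A) S = S diag (x - μ)` and cancel `det S`.
    charPoly-eigenbasis : ∀ x → charPoly A x ≈ product λ k → x - μ k
    charPoly-eigenbasis x = x∙y⁻¹≈ε⇒x≈y _ _ (*-zero-cancelˡ {det S} {det X - product d} detS≉0 (begin
      det S * (det X - product d)
        ≈⟨ solve 3 (λ s x p → s :* (x :- p) := x :* s :- s :* p) refl (det S) (det X) (product d) ⟩
      det X * det S - det S * product d
        ≈⟨ +-cong (det-· X S) (-‿cong (trans (det-· S (diag d)) (*-congˡ {det S} (det-diag d)))) ⟨
      det (X · S) - det (S · diag d)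
        ≈⟨ +-congʳ { - det (S · diag d)} (det-cong XS≋Sd) ⟩
      det (S · diag d) - det (S · diag d)
        ≈⟨ -‿inverseʳ (det (S · diag d)) ⟩
      0# ∎))
      where
      X : Rows n n
      X i j = diag (λ _ → x) i j + - A i j

      d : Row n
      d k = x - μ k

      XS≋Sd : ∀ i → (X · S) i ≋ (S · diag d) i
      XS≋Sd i k = begin
        (X · S) i k
          ≈⟨ sum-linear {f = λ j → X i j * S j k} {λ j → A i j * S j k}
               {λ j → diag (λ _ → x) i j * S j k} (- 1#)
               (λ j → solve 3 (λ x a s → (x :- a) :* s := (:- :1) :* (a :* s) :+ x :* s) refl
                 (diag (λ _ → x) i j) (A i j) (S j k)) ⟩
        - 1# * (A · S) i k + sum (λ j → diag (λ _ → x) i j * S j k)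
          ≈⟨ +-cong (*-congˡ { - 1#} (AS≋Sμ i k))
               (trans (sum-single {f = λ j → diag (λ _ → x) i j * S j k} i
                        λ j i≢j → trans (*-congʳ {S j k} (diag-≢ (λ _ → x) i≢j)) (zeroˡ (S j k)))
                      (*-congʳ {S i k} (diag-≡ (λ _ → x) {i} ≡.refl))) ⟩
        - 1# * (S i k * μ k) + x * S i k
          ≈⟨ solve 3 (λ s m x → (:- :1) :* (s :* m) :+ x :* s := s :* (x :- m)) refl (S i k) (μ k) x ⟩
        S i k * d k
          ≈⟨ *-congˡ {S i k} (diag-≡ d {k} ≡.refl) ⟨
        S i k * diag d k k
          ≈⟨ sum-single {f = λ j → S i j * diag d j k} k
               (λ j k≢j → trans (*-congˡ {S i j} (diag-≢ d (k≢j ∘ ≡.sym))) (zeroʳ (S i j))) ⟨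
        (S · diag d) i k ∎

    isSpectrum-eigenbasis : IsSpectrum A (List.tabulate μ)
    isSpectrum-eigenbasis = List.length-tabulate μ , λ x →
      trans (charPoly-eigenbasis x) (reflexive (foldr-tabulate x μ))
      where
      foldr-tabulate : ∀ {m} x (μ : Row m) →
        product (λ k → x - μ k) ≡ List.foldr (λ z p → (x - z) * p) 1# (List.tabulate μ)
      foldr-tabulate {zero}  x μ = ≡.refl
      foldr-tabulate {suc m} x μ = ≡.cong ((x - μ zero) *_) (foldr-tabulate x (μ ∘ suc))

-- Eigenvalues of the product of a signed cycle with K₂.

module CycleTimesK₂ {c ℓ} (F : CompleteOrderedField c ℓ) where
  open ComplexNumbers F
  open Determinant ℂ-commutativeRing hiding (det)
  open RootsOfUnity F using (PrimitiveRoot; primitiveRoot)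
  open Spectral F using (signValue; adjacency; charPoly; IsSpectrum; HasEnergy; Cospectral; sumAbsRe; det)
  open Eigenbases F
  open PairSums ℂ-commutativeRing
  open IntegerSolver ℂ-commutativeRing
  open SetoidReasoning setoid

  signValue-* : ∀ s t → signValue (s Sign.* t) ≈ signValue s * signValue t
  signValue-* Sign.+ t      = sym (*-identityˡ (signValue t))
  signValue-* Sign.- Sign.+ = sym (*-identityʳ (- 1#))
  signValue-* Sign.- Sign.- = solve 0 (:1 := (:- :1) :* (:- :1)) refl

  signValue-square : ∀ s → signValue s * signValue s ≈ 1#
  signValue-square s = trans (sym (signValue-* s s)) (reflexive (≡.cong signValue (Sign.s*s≡+ s)))

  geometric : ∀ n q → (q - 1#) * sum {n} (λ j → q ^ toℕ j) ≈ q ^ n - 1#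
  geometric zero    q = solve 1 (λ q → (q :- :1) :* :0 := :1 :- :1) refl q
  geometric (suc n) q = begin
    (q - 1#) * (1# + sum {n} (λ j → q * q ^ toℕ j))
      ≈⟨ *-congˡ {q - 1#} (+-congˡ {1#} (*-distribˡ-sum q (λ j → q ^ toℕ {n} j))) ⟨
    (q - 1#) * (1# + q * sum {n} (λ j → q ^ toℕ j))
      ≈⟨ solve 2 (λ q s → (q :- :1) :* (:1 :+ q :* s) := (q :- :1) :+ q :* ((q :- :1) :* s))
           refl q (sum {n} (λ j → q ^ toℕ j)) ⟩
    (q - 1#) + q * ((q - 1#) * sum {n} (λ j → q ^ toℕ j))
      ≈⟨ +-congˡ {q - 1#} (*-congˡ {q} (geometric n q)) ⟩
    (q - 1#) + q * (q ^ n - 1#)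
      ≈⟨ solve 2 (λ q p → (q :- :1) :+ q :* (p :- :1) := q :* p :- :1) refl q (q ^ n) ⟩
    q * q ^ n - 1# ∎
    where open SemiringSums semiring using (*-distribˡ-sum)

  module Roots {n} (root : PrimitiveRoot n) {s α}
    (α^n : α ^ n ≈ signValue s) (norm-α : norm α ℝ.≈ ℝ.1#) where
    open PrimitiveRoot root

    ω : ℂ
    ω = ζ * ζ

    norm-ω : norm ω ℝ.≈ ℝ.1#
    norm-ω = norm-unit-* {ζ} {ζ} norm-ζ norm-ζ

    ω^n : ω ^ n ≈ 1#
    ω^n = begin
      (ζ * ζ) ^ n       ≈⟨ ^-distrib-* ζ ζ n ⟩
      ζ ^ n * ζ ^ n     ≈⟨ *-cong ζ^n ζ^n ⟩
      - 1# * - 1#       ≈⟨ signValue-square Sign.- ⟩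
      1#                ∎

    -- One root `α` is rotated by the powers of `ω`; later `α` is `1#` for the positive cycle and
    -- `ζ` for the negative one.
    z : Fin n → ℂ
    z j = α * ω ^ toℕ j

    norm-z : ∀ j → norm (z j) ℝ.≈ ℝ.1#
    norm-z j = norm-unit-* {α} {ω ^ toℕ j} norm-α (norm-unit-^ norm-ω (toℕ j))

    ^-comm-exponents : ∀ x k l → (x ^ k) ^ l ≈ (x ^ l) ^ k
    ^-comm-exponents x k l = begin
      (x ^ k) ^ l      ≈⟨ ^-assocʳ x k l ⟩
      x ^ (k ℕ.* l)    ≡⟨ ≡.cong (x ^_) (ℕ.*-comm k l) ⟩
      x ^ (l ℕ.* k)    ≈⟨ ^-assocʳ x l k ⟨
      (x ^ l) ^ k      ∎

    z^n : ∀ j → z j ^ n ≈ signValue s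
    z^n j = begin
      (α * ω ^ toℕ j) ^ n          ≈⟨ ^-distrib-* α (ω ^ toℕ j) n ⟩
      α ^ n * (ω ^ toℕ j) ^ n      ≈⟨ *-cong α^n (^-comm-exponents ω (toℕ j) n) ⟩
      signValue s * (ω ^ n) ^ toℕ j ≈⟨ *-congˡ {signValue s} (trans (^-congˡ (toℕ j) ω^n) (1#^ (toℕ j))) ⟩
      signValue s * 1#             ≈⟨ *-identityʳ (signValue s) ⟩
      signValue s                  ∎

    -- Cancelling `ω ^ k` by its conjugate leaves `ω ^ (l ∸ k) ≈ 1#`, which primitivity excludes.
    ω^-injective-< : ∀ {k l} → k ℕ.< l → l ℕ.< n → ¬ (ω ^ k ≈ ω ^ l)
    ω^-injective-< {k} {l} k<l l<n ω^k≈ω^l = ζ²^≉1 (l ℕ.∸ k)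
      (ℕ.m<n⇒0<n∸m k<l) (ℕ.≤-<-trans (ℕ.m∸n≤m l k) l<n) (begin
        ω ^ (l ℕ.∸ k)
          ≈⟨ *-identityˡ (ω ^ (l ℕ.∸ k)) ⟨
        1# * ω ^ (l ℕ.∸ k)
          ≈⟨ *-congʳ {ω ^ (l ℕ.∸ k)} unit ⟨
        ω ^ k * conj (ω ^ k) * ω ^ (l ℕ.∸ k)
          ≈⟨ solve 3 (λ a b c → a :* b :* c := b :* (a :* c)) refl
               (ω ^ k) (conj (ω ^ k)) (ω ^ (l ℕ.∸ k)) ⟩
        conj (ω ^ k) * (ω ^ k * ω ^ (l ℕ.∸ k))
          ≈⟨ *-congˡ {conj (ω ^ k)} (^-homo-* ω k (l ℕ.∸ k)) ⟨
        conj (ω ^ k) * ω ^ (k ℕ.+ (l ℕ.∸ k))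
          ≡⟨ ≡.cong (λ m → conj (ω ^ k) * ω ^ m) (ℕ.m+[n∸m]≡n (ℕ.<⇒≤ k<l)) ⟩
        conj (ω ^ k) * ω ^ l
          ≈⟨ *-congˡ {conj (ω ^ k)} ω^k≈ω^l ⟨
        conj (ω ^ k) * ω ^ k
          ≈⟨ *-comm (conj (ω ^ k)) (ω ^ k) ⟩
        ω ^ k * conj (ω ^ k)
          ≈⟨ unit ⟩
        1# ∎)
      where
      unit : ω ^ k * conj (ω ^ k) ≈ 1#
      unit = unit-conj {ω ^ k} (norm-unit-^ norm-ω k)

    ω^-injective : ∀ {i j : Fin n} → ω ^ toℕ i ≈ ω ^ toℕ j → i ≡ j
    ω^-injective {i} {j} eq with ℕ.<-cmp (toℕ i) (toℕ j)
    ... | tri< i<j _ _ = contradiction eq (ω^-injective-< i<j (Fin.toℕ<n j))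
    ... | tri≈ _ i≡j _ = Fin.toℕ-injective i≡j
    ... | tri> _ _ j<i = contradiction (sym eq) (ω^-injective-< j<i (Fin.toℕ<n i))

    -- The summand is geometric in `j`. Its ratio `q` is `ω` to the power `i - i′`, with conjugates
    -- for the negative exponents; `q ^ n` is one but `q` is not.
    orthogonal : ∀ {i i′ : Fin n} → i ≢ i′ →
      sum (λ j → z j ^ toℕ i * conj (z j) ^ toℕ i′) ≈ 0#
    orthogonal {i} {i′} i≢i′ = begin
      sum (λ j → z j ^ toℕ i * conj (z j) ^ toℕ i′)
        ≈⟨ sum-cong-≋ {n} {λ j → z j ^ toℕ i * conj (z j) ^ toℕ i′} {λ j → κ * q ^ toℕ j} term ⟩
      sum {n} (λ j → κ * q ^ toℕ j)
        ≈⟨ *-distribˡ-sum κ (λ j → q ^ toℕ {n} j) ⟨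
      κ * sum {n} (λ j → q ^ toℕ j)
        ≈⟨ *-congˡ {κ} (*-zero-cancelˡ {q - 1#} {sum {n} (λ j → q ^ toℕ j)} q-1≉0
             (trans (geometric n q) (trans (+-congʳ { - 1#} q^n) (-‿inverseʳ 1#)))) ⟩
      κ * 0#
        ≈⟨ zeroʳ κ ⟩
      0# ∎
      where
      open SemiringSums semiring using (*-distribˡ-sum)
      κ = α ^ toℕ i * conj α ^ toℕ i′
      q = ω ^ toℕ i * conj ω ^ toℕ i′

      term : ∀ j → z j ^ toℕ i * conj (z j) ^ toℕ i′ ≈ κ * q ^ toℕ j
      term j = begin
        z j ^ toℕ i * conj (z j) ^ toℕ i′
          ≈⟨ *-congˡ {z j ^ toℕ i} (^-congˡ (toℕ i′)
               (trans (conj-* α (ω ^ toℕ j)) (*-congˡ {conj α} (conj-^ ω (toℕ j))))) ⟩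
        (α * ω ^ toℕ j) ^ toℕ i * (conj α * conj ω ^ toℕ j) ^ toℕ i′
          ≈⟨ *-cong (^-distrib-* α (ω ^ toℕ j) (toℕ i)) (^-distrib-* (conj α) (conj ω ^ toℕ j) (toℕ i′)) ⟩
        α ^ toℕ i * (ω ^ toℕ j) ^ toℕ i * (conj α ^ toℕ i′ * (conj ω ^ toℕ j) ^ toℕ i′)
          ≈⟨ *-cong (*-congˡ {α ^ toℕ i} (^-comm-exponents ω (toℕ j) (toℕ i)))
                    (*-congˡ {conj α ^ toℕ i′} (^-comm-exponents (conj ω) (toℕ j) (toℕ i′))) ⟩
        α ^ toℕ i * (ω ^ toℕ i) ^ toℕ j * (conj α ^ toℕ i′ * (conj ω ^ toℕ i′) ^ toℕ j)
          ≈⟨ solve 4 (λ a b c d → a :* b :* (c :* d) := a :* c :* (b :* d)) refl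
               (α ^ toℕ i) ((ω ^ toℕ i) ^ toℕ j) (conj α ^ toℕ i′) ((conj ω ^ toℕ i′) ^ toℕ j) ⟩
        κ * ((ω ^ toℕ i) ^ toℕ j * (conj ω ^ toℕ i′) ^ toℕ j)
          ≈⟨ *-congˡ {κ} (^-distrib-* (ω ^ toℕ i) (conj ω ^ toℕ i′) (toℕ j)) ⟨
        κ * q ^ toℕ j ∎

      q^n : q ^ n ≈ 1#
      q^n = begin
        q ^ n
          ≈⟨ ^-distrib-* (ω ^ toℕ i) (conj ω ^ toℕ i′) n ⟩
        (ω ^ toℕ i) ^ n * (conj ω ^ toℕ i′) ^ n
          ≈⟨ *-cong (^-comm-exponents ω (toℕ i) n) (^-comm-exponents (conj ω) (toℕ i′) n) ⟩
        (ω ^ n) ^ toℕ i * (conj ω ^ n) ^ toℕ i′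
          ≈⟨ *-cong (^-congˡ (toℕ i) ω^n) (^-congˡ (toℕ i′)
               -- Both sides of `conj-^ 1# 0` are zeroth powers, so it reads `conj 1# ≈ 1#`.
               (trans (sym (conj-^ ω n)) (trans (conj-cong {ω ^ n} {1#} ω^n) (conj-^ 1# 0)))) ⟩
        1# ^ toℕ i * 1# ^ toℕ i′
          ≈⟨ *-cong (1#^ (toℕ i)) (1#^ (toℕ i′)) ⟩
        1# * 1#
          ≈⟨ *-identityˡ 1# ⟩
        1# ∎

      q-1≉0 : ¬ (q - 1# ≈ 0#)
      q-1≉0 q-1≈0 = i≢i′ (ω^-injective (begin
        ω ^ toℕ i
          ≈⟨ *-identityʳ (ω ^ toℕ i) ⟨
        ω ^ toℕ i * 1#
          ≈⟨ *-congˡ {ω ^ toℕ i} (unit-conj {ω ^ toℕ i′} (norm-unit-^ norm-ω (toℕ i′))) ⟨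
        ω ^ toℕ i * (ω ^ toℕ i′ * conj (ω ^ toℕ i′))
          ≈⟨ *-congˡ {ω ^ toℕ i} (*-congˡ {ω ^ toℕ i′} (conj-^ ω (toℕ i′))) ⟩
        ω ^ toℕ i * (ω ^ toℕ i′ * conj ω ^ toℕ i′)
          ≈⟨ solve 3 (λ a b c → a :* (b :* c) := a :* c :* b) refl
               (ω ^ toℕ i) (ω ^ toℕ i′) (conj ω ^ toℕ i′) ⟩
        q * ω ^ toℕ i′
          ≈⟨ *-congʳ {ω ^ toℕ i′} (x∙y⁻¹≈ε⇒x≈y q 1# q-1≈0) ⟩
        1# * ω ^ toℕ i′
          ≈⟨ *-identityˡ (ω ^ toℕ i′) ⟩
        ω ^ toℕ i′ ∎))

    z-unit : ∀ j k → z j ^ k * conj (z j) ^ k ≈ 1#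
    z-unit j k = begin
      z j ^ k * conj (z j) ^ k    ≈⟨ ^-distrib-* (z j) (conj (z j)) k ⟨
      (z j * conj (z j)) ^ k      ≈⟨ ^-congˡ k (unit-conj {z j} (norm-z j)) ⟩
      1# ^ k                      ≈⟨ 1#^ k ⟩
      1#                          ∎

  τ : Fin 2 → ℂ
  τ zero       = 1#
  τ (suc zero) = - 1#

  cycleEigenvector : ∀ {n} → (Fin n → Sign) → ℂ → Row n
  cycleEigenvector σ z i = signValue (partialSign σ i) * z ^ toℕ i

  -- Off the closing arc, `σ i` meets itself in the next partial product and squares to one. At the
  -- closing arc the vector restarts at 1, and `z ^ n`, being the product of all signs, makes up for
  -- this.
  cycleEigenvector-next : ∀ {n} (σ : Fin n → Sign) z →
    z ^ n ≈ signValue (Vector.foldr Sign._*_ Sign.+ σ) → ∀ i →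
    signValue (σ i) * cycleEigenvector σ z (next i) ≈ z * cycleEigenvector σ z i
  cycleEigenvector-next {suc n} σ z z^n i with view i
  ... | ‵inject₁ i = begin
    signValue (σ i₁) * cycleEigenvector σ z (next i₁)
      ≡⟨ ≡.cong (λ k → signValue (σ i₁) * cycleEigenvector σ z k) (next-inject₁ i) ⟩
    signValue (σ i₁) * (signValue (partialSign σ (suc i)) * (z * z ^ toℕ i))
      ≈⟨ *-congˡ {signValue (σ i₁)} (*-congʳ {z * z ^ toℕ i}
           (trans (reflexive (≡.cong signValue (partialSign-suc σ i)))
                  (signValue-* (partialSign σ i₁) (σ i₁)))) ⟩
    signValue (σ i₁) * (signValue (partialSign σ i₁) * signValue (σ i₁) * (z * z ^ toℕ i))
      ≈⟨ solve 4 (λ s p z w → s :* (p :* s :* (z :* w)) := s :* s :* (z :* (p :* w))) refl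
           (signValue (σ i₁)) (signValue (partialSign σ i₁)) z (z ^ toℕ i) ⟩
    signValue (σ i₁) * signValue (σ i₁) * (z * (signValue (partialSign σ i₁) * z ^ toℕ i))
      ≈⟨ *-congʳ {z * (signValue (partialSign σ i₁) * z ^ toℕ i)} (signValue-square (σ i₁)) ⟩
    1# * (z * (signValue (partialSign σ i₁) * z ^ toℕ i))
      ≈⟨ *-identityˡ (z * (signValue (partialSign σ i₁) * z ^ toℕ i)) ⟩
    z * (signValue (partialSign σ i₁) * z ^ toℕ i)
      ≡⟨ ≡.cong (λ k → z * (signValue (partialSign σ i₁) * z ^ k)) (Fin.toℕ-inject₁ i) ⟨
    z * cycleEigenvector σ z i₁ ∎
    where i₁ = inject₁ i
  ... | ‵fromℕ = begin
    signValue (σ iₙ) * cycleEigenvector σ z (next iₙ)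
      ≡⟨ ≡.cong (λ k → signValue (σ iₙ) * cycleEigenvector σ z k) (next-fromℕ n) ⟩
    signValue (σ iₙ) * (1# * 1#)
      ≈⟨ solve 1 (λ s → s :* (:1 :* :1) := :1 :* s) refl (signValue (σ iₙ)) ⟩
    1# * signValue (σ iₙ)
      -- Inserting the square of the last partial sign completes `σ iₙ` to the product of all signs,
      -- which is `z ^ n`.
      ≈⟨ *-congʳ {signValue (σ iₙ)} (signValue-square (partialSign σ iₙ)) ⟨
    signValue (partialSign σ iₙ) * signValue (partialSign σ iₙ) * signValue (σ iₙ)
      ≈⟨ *-assoc (signValue (partialSign σ iₙ)) (signValue (partialSign σ iₙ)) (signValue (σ iₙ)) ⟩
    signValue (partialSign σ iₙ) * (signValue (partialSign σ iₙ) * signValue (σ iₙ))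
      ≈⟨ *-congˡ {signValue (partialSign σ iₙ)} (signValue-* (partialSign σ iₙ) (σ iₙ)) ⟨
    signValue (partialSign σ iₙ) * signValue (partialSign σ iₙ Sign.* σ iₙ)
      ≈⟨ *-congˡ {signValue (partialSign σ iₙ)}
           (trans (reflexive (≡.cong signValue (partialSign-fromℕ σ))) (sym z^n)) ⟩
    signValue (partialSign σ iₙ) * (z * z ^ n)
      ≈⟨ solve 3 (λ p z w → p :* (z :* w) := z :* (p :* w)) refl
           (signValue (partialSign σ iₙ)) z (z ^ n) ⟩
    z * (signValue (partialSign σ iₙ) * z ^ n)
      ≡⟨ ≡.cong (λ k → z * (signValue (partialSign σ iₙ) * z ^ k)) (Fin.toℕ-fromℕ n) ⟨
    z * cycleEigenvector σ z iₙ ∎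
    where iₙ = Fin.fromℕ n

  module Spectrum {n s} (C : Sidigraph) (cycle : IsSignedCycle s n C) (0<n : 0 ℕ.< n)
    (root : PrimitiveRoot n) {α} (α^n : α ^ n ≈ signValue s) (norm-α : norm α ℝ.≈ ℝ.1#) where
    open IsSignedCycle cycle
    open Roots root {s} {α} α^n norm-α
    open Sidigraph (C □ K₂↔) using (arc; vertexAt; enumeration)
    private
      module C = Sidigraph C

    N : ℕ
    N = order (C □ K₂↔)

    -- The given enumeration of `C` need not follow its arcs, so matrix indices are translated into
    -- a place on the cycle and a copy of the cycle.
    positions : Fin N ↔ (Fin n × Fin 2)
    positions = (↔-sym vertices ×-↔ ↔-id (Fin 2)) ↔-∘ ↔-sym enumeration

    order-□ : N ≡ 2 ℕ.* n
    order-□ = ≡.trans (Permutation.↔⇒≡ (↔-sym Fin.*↔× ↔-∘ positions)) (ℕ.*-comm n 2)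

    position : Fin N → Fin n × Fin 2
    position = Inverse.to positions

    vertex : Fin n × Fin 2 → V (C □ K₂↔)
    vertex (a , b) = v a , b

    vertex-position : ∀ i → vertex (position i) ≡ vertexAt i
    vertex-position i = ≡.cong (_, proj₂ (vertexAt i))
      (Inverse.strictlyInverseˡ vertices (proj₁ (vertexAt i)))

    position-injective : ∀ {i j} → position i ≡ position j → i ≡ j
    position-injective {i} {j} eq = ≡.trans (≡.sym (Inverse.strictlyInverseʳ positions i))
      (≡.trans (≡.cong (Inverse.from positions) eq) (Inverse.strictlyInverseʳ positions j))

    v-injective : ∀ {a a′} → v a ≡ v a′ → a ≡ a′
    v-injective {a} {a′} eq = ≡.trans (≡.sym (Inverse.strictlyInverseʳ vertices a))
      (≡.trans (≡.cong (Inverse.from vertices) eq) (Inverse.strictlyInverseʳ vertices a′))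

    entry : Fin n × Fin 2 → Fin n × Fin 2 → ℂ
    entry x y = maybe′ signValue 0# (arc (vertex x) (vertex y))

    adjacency-entry : ∀ i j → adjacency (C □ K₂↔) i j ≡ entry (position i) (position j)
    adjacency-entry i j = ≡.cong₂ (λ x y → maybe′ signValue 0# (arc x y))
      (≡.sym (vertex-position i)) (≡.sym (vertex-position j))

    flip : Fin 2 → Fin 2
    flip zero       = suc zero
    flip (suc zero) = zero

    value-if : ∀ (p q : Bool) (s : Sign) →
      maybe′ signValue 0# ((if p then just s else nothing) <∣> (if q then nothing else nothing))
        ≡ (if p then signValue s else 0#)
    value-if false false s = ≡.refl
    value-if false true  s = ≡.refl
    value-if true  false s = ≡.refl
    value-if true  true  s = ≡.refl

    entry-same : ∀ a a′ b → entry (a , b) (a′ , b) ≡ diag (λ _ → signValue (σ a)) a′ (next a)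
    entry-same a a′ zero rewrite arcs a a′ =
      value-if (does (a′ Fin.≟ next a)) (does (v a C.≟ᵥ v a′)) (σ a)
    entry-same a a′ (suc zero) rewrite arcs a a′ =
      value-if (does (a′ Fin.≟ next a)) (does (v a C.≟ᵥ v a′)) (σ a)

    ≟ᵥ-v : ∀ a a′ → does (v a C.≟ᵥ v a′) ≡ does (a Fin.≟ a′)
    ≟ᵥ-v a a′ with a Fin.≟ a′
    ... | yes a≡a′ = dec-true (v a C.≟ᵥ v a′) (≡.cong v a≡a′)
    ... | no a≢a′  = dec-false (v a C.≟ᵥ v a′) (a≢a′ ∘ v-injective)

    value-if′ : ∀ (p : Bool) →
      maybe′ signValue 0# (if p then just Sign.+ else nothing) ≡ (if p then 1# else 0#)
    value-if′ false = ≡.refl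
    value-if′ true  = ≡.refl

    entry-flip : ∀ a a′ b → entry (a , b) (a′ , flip b) ≡ I a a′
    entry-flip a a′ zero       rewrite ≟ᵥ-v a a′ = value-if′ (does (a Fin.≟ a′))
    entry-flip a a′ (suc zero) rewrite ≟ᵥ-v a a′ = value-if′ (does (a Fin.≟ a′))

    module _ (h : Fin n × Fin 2 → ℂ) where

      entries-action : ∀ a b →
        sum (λ a′ → entry (a , b) (a′ , b) * h (a′ , b) + entry (a , b) (a′ , flip b) * h (a′ , flip b))
          ≈ signValue (σ a) * h (next a , b) + h (a , flip b)
      entries-action a b = begin
        sum (λ a′ → entry (a , b) (a′ , b) * h (a′ , b) + entry (a , b) (a′ , flip b) * h (a′ , flip b))
          ≈⟨ ∑-distrib-+ f g ⟩
        sum f + sum g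
          ≈⟨ +-cong (sum-single {f = f} (next a) λ a′ next≢a′ →
                      trans (*-congʳ {h (a′ , b)} (trans (reflexive (entry-same a a′ b))
                        (diag-≢ (λ _ → signValue (σ a)) (next≢a′ ∘ ≡.sym)))) (zeroˡ (h (a′ , b))))
                    (sum-single {f = g} a λ a′ a≢a′ →
                      trans (*-congʳ {h (a′ , flip b)} (trans (reflexive (entry-flip a a′ b))
                        (diag-≢ (λ _ → 1#) a≢a′))) (zeroˡ (h (a′ , flip b)))) ⟩
        f (next a) + g a
          ≈⟨ +-cong (*-congʳ {h (next a , b)} (trans (reflexive (entry-same a (next a) b))
                      (diag-≡ (λ _ → signValue (σ a)) {next a} ≡.refl)))
                    (trans (*-congʳ {h (a , flip b)} (trans (reflexive (entry-flip a a b))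
                      (diag-≡ (λ _ → 1#) {a} ≡.refl))) (*-identityˡ (h (a , flip b)))) ⟩
        signValue (σ a) * h (next a , b) + h (a , flip b) ∎
        where
        f g : Row n
        f a′ = entry (a , b) (a′ , b) * h (a′ , b)
        g a′ = entry (a , b) (a′ , flip b) * h (a′ , flip b)

      -- The matrix acts as the signed shift along the cycle plus the exchange of the two copies, so
      -- it never has to be written out.
      adjacency-action : ∀ i → let (a , b) = position i in
        sum (λ j → adjacency (C □ K₂↔) i j * h (position j))
          ≈ signValue (σ a) * h (next a , b) + h (a , flip b)
      adjacency-action i = begin
        sum (λ j → adjacency (C □ K₂↔) i j * h (position j))
          ≈⟨ sum-cong-≋ (λ j → *-congʳ {h (position j)} (reflexive (adjacency-entry i j))) ⟩
        sum (λ j → entry (position i) (position j) * h (position j))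
          ≈⟨ sum-pairs positions (λ y → entry (position i) y * h y) ⟩
        sum (λ a′ → entry (position i) (a′ , zero) * h (a′ , zero) +
                    entry (position i) (a′ , suc zero) * h (a′ , suc zero))
          ≈⟨ ordered (proj₂ (position i)) ⟩
        signValue (σ a) * h (next a , b) + h (a , flip b) ∎
        where
        a = proj₁ (position i)
        b = proj₂ (position i)

        -- `sum-pairs` always lists copy `zero` first, while `entries-action` lists the copy `b`
        -- itself first.
        ordered : ∀ b →
          sum (λ a′ → entry (a , b) (a′ , zero) * h (a′ , zero) +
                      entry (a , b) (a′ , suc zero) * h (a′ , suc zero))
            ≈ signValue (σ a) * h (next a , b) + h (a , flip b)
        ordered zero       = entries-action a zero
        ordered (suc zero) = trans
          (sum-cong-≋ λ a′ → +-comm (entry (a , suc zero) (a′ , zero) * h (a′ , zero))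
                                    (entry (a , suc zero) (a′ , suc zero) * h (a′ , suc zero)))
          (entries-action a (suc zero))

    t : Fin 2 → Fin 2 → ℂ
    t c zero       = 1#
    t c (suc zero) = τ c

    t-flip : ∀ c b → t c (flip b) ≈ τ c * t c b
    t-flip c          zero       = sym (*-identityʳ (τ c))
    t-flip zero       (suc zero) = sym (signValue-square Sign.+)
    t-flip (suc zero) (suc zero) = sym (signValue-square Sign.-)

    eigenvector : (Fin n → ℂ) → Fin n × Fin 2 → Fin n × Fin 2 → ℂ
    eigenvector ζ (j , c) (a , b) = cycleEigenvector σ (ζ j) a * t c b

    μ : Fin n × Fin 2 → ℂ
    μ (j , c) = z j + τ c

    S T : Rows N N
    S i k = eigenvector z (position k) (position i)
    T k i = eigenvector (conj ∘ z) (position k) (position i)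

    AS≋Sμ : ∀ i k → (adjacency (C □ K₂↔) · S) i k ≈ S i k * μ (position k)
    AS≋Sμ i k = trans (adjacency-action (eigenvector z (position k)) i)
      (step (proj₁ (position i)) (proj₂ (position i)) (proj₁ (position k)) (proj₂ (position k)))
      where
      step : ∀ a b j c →
        signValue (σ a) * eigenvector z (j , c) (next a , b) + eigenvector z (j , c) (a , flip b)
          ≈ eigenvector z (j , c) (a , b) * (z j + τ c)
      step a b j c = begin
        signValue (σ a) * (g (next a) * t c b) + g a * t c (flip b)
          ≈⟨ +-cong (sym (*-assoc (signValue (σ a)) (g (next a)) (t c b))) (*-congˡ {g a} (t-flip c b)) ⟩
        signValue (σ a) * g (next a) * t c b + g a * (τ c * t c b)
          ≈⟨ +-congʳ {g a * (τ c * t c b)} (*-congʳ {t c b}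
               (cycleEigenvector-next σ (z j)
                 (trans (z^n j) (reflexive (≡.cong signValue (≡.sym sign)))) a)) ⟩
        z j * g a * t c b + g a * (τ c * t c b)
          ≈⟨ solve 4 (λ z g t τ → z :* g :* t :+ g :* (τ :* t) := g :* t :* (z :+ τ)) refl
               (z j) (g a) (t c b) (τ c) ⟩
        g a * t c b * (z j + τ c) ∎
        where
        g : Row n
        g = cycleEigenvector σ (z j)

    -- This is `2n`, kept as a sum to match the diagonal entries of `S · T` term by term.
    κ : ℂ
    κ = sum {n} λ _ → 1# + 1#

    κ≉0 : ¬ (κ ≈ 0#)
    κ≉0 (re≈0 , _) = ℝ.<⇒≉ (positive n 0<n) re≈0
      where
      0≤1+1 : ℝ.0# ℝ.≤ ℝ.1# ℝ.+ ℝ.1#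
      0≤1+1 = ℝ.+-nonneg ℝ.0≤1 ℝ.0≤1

      nonneg : ∀ m → ℝ.0# ℝ.≤ re (sum {m} λ _ → 1# + 1#)
      nonneg zero    = ℝ.≤-refl
      nonneg (suc m) = ℝ.+-nonneg 0≤1+1 (nonneg m)

      positive : ∀ m → 0 ℕ.< m → ℝ.0# ℝ.< re (sum {m} λ _ → 1# + 1#)
      positive (suc m) _ = ℝ.+-pos (ℝ.+-pos ℝ.0<1 ℝ.0≤1) (nonneg m)

    dotτ : Fin 2 → Fin 2 → ℂ
    dotτ b b′ = t zero b * t zero b′ + t (suc zero) b * t (suc zero) b′

    dotτ-≡ : ∀ b → dotτ b b ≈ 1# + 1#
    dotτ-≡ zero       = +-cong (*-identityˡ 1#) (*-identityˡ 1#)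
    dotτ-≡ (suc zero) = +-cong (*-identityˡ 1#) (signValue-square Sign.-)

    dotτ-≢ : ∀ {b b′} → b ≢ b′ → dotτ b b′ ≈ 0#
    dotτ-≢ {zero}     {zero}     b≢b′ = contradiction ≡.refl b≢b′
    dotτ-≢ {zero}     {suc zero} b≢b′ = solve 0 (:1 :* :1 :+ :1 :* (:- :1) := :0) refl
    dotτ-≢ {suc zero} {zero}     b≢b′ = solve 0 (:1 :* :1 :+ (:- :1) :* :1 := :0) refl
    dotτ-≢ {suc zero} {suc zero} b≢b′ = contradiction ≡.refl b≢b′

    -- The sum runs over the eigenvectors with two vertices fixed, so these are orthogonality
    -- relations between the rows of `S`. Each entry splits into a factor from the roots, zero if
    -- the places on the cycle differ, and a factor from `τ`, zero if the copies differ.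
    ST≋κ : ∀ i → (S · T) i ≋ diag (λ _ → κ) i
    ST≋κ i i′ = begin
      (S · T) i i′
        ≈⟨ sum-pairs positions (λ x → eigenvector z x (a , b) * eigenvector (conj ∘ z) x (a′ , b′)) ⟩
      sum (λ j → eigenvector z (j , zero) (a , b) * eigenvector (conj ∘ z) (j , zero) (a′ , b′) +
                 eigenvector z (j , suc zero) (a , b) * eigenvector (conj ∘ z) (j , suc zero) (a′ , b′))
        ≈⟨ sum-cong-≋ regroup ⟩
      sum (λ j → r * dotτ b b′ * (z j ^ toℕ a * conj (z j) ^ toℕ a′))
        ≈⟨ total ⟩
      diag (λ _ → κ) i i′ ∎
      where
      open SemiringSums semiring using (*-distribˡ-sum)
      a  = proj₁ (position i)
      b  = proj₂ (position i)
      a′ = proj₁ (position i′)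
      b′ = proj₂ (position i′)
      r  = signValue (partialSign σ a) * signValue (partialSign σ a′)

      regroup : ∀ j →
        eigenvector z (j , zero) (a , b) * eigenvector (conj ∘ z) (j , zero) (a′ , b′) +
        eigenvector z (j , suc zero) (a , b) * eigenvector (conj ∘ z) (j , suc zero) (a′ , b′)
          ≈ r * dotτ b b′ * (z j ^ toℕ a * conj (z j) ^ toℕ a′)
      regroup j = solve 8 (λ s z t u s′ z′ t′ u′ →
          s :* z :* t :* (s′ :* z′ :* t′) :+ s :* z :* u :* (s′ :* z′ :* u′) :=
          s :* s′ :* (t :* t′ :+ u :* u′) :* (z :* z′)) refl
        (signValue (partialSign σ a)) (z j ^ toℕ a) (t zero b) (t (suc zero) b)
        (signValue (partialSign σ a′)) (conj (z j) ^ toℕ a′) (t zero b′) (t (suc zero) b′)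

      off-diagonal : i ≢ i′ →
        r * dotτ b b′ * sum (λ j → z j ^ toℕ a * conj (z j) ^ toℕ a′) ≈ 0#
      off-diagonal i≢i′ with a Fin.≟ a′
      ... | no a≢a′  = trans (*-congˡ {r * dotτ b b′} (orthogonal a≢a′)) (zeroʳ (r * dotτ b b′))
      ... | yes a≡a′ = begin
        r * dotτ b b′ * Σz    ≈⟨ *-congʳ {Σz} (*-congˡ {r} (dotτ-≢ λ b≡b′ →
                                      i≢i′ (position-injective (≡.cong₂ _,_ a≡a′ b≡b′)))) ⟩
        r * 0# * Σz              ≈⟨ solve 2 (λ r x → r :* :0 :* x := :0) refl r Σz ⟩
        0#                       ∎
        where Σz = sum λ j → z j ^ toℕ a * conj (z j) ^ toℕ a′

      total : sum (λ j → r * dotτ b b′ * (z j ^ toℕ a * conj (z j) ^ toℕ a′)) ≈ diag (λ _ → κ) i i′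
      total with i Fin.≟ i′
      ... | no i≢i′     = trans
        (sym (*-distribˡ-sum (r * dotτ b b′) (λ j → z j ^ toℕ a * conj (z j) ^ toℕ a′)))
        (off-diagonal i≢i′)
      ... | yes ≡.refl = sum-cong-≋ λ j → begin
        r * dotτ b b * (z j ^ toℕ a * conj (z j) ^ toℕ a)
          ≈⟨ *-cong (*-cong (signValue-square (partialSign σ a)) (dotτ-≡ b)) (z-unit j (toℕ a)) ⟩
        1# * (1# + 1#) * 1#
          ≈⟨ solve 0 (:1 :* (:1 :+ :1) :* :1 := :1 :+ :1) refl ⟩
        1# + 1# ∎

    detS≉0 : ¬ (det S ≈ 0#)
    detS≉0 = det-≉0 S T (λ _ → κ) ST≋κ λ _ → κ≉0

    charPoly-□ : ∀ x → charPoly (adjacency (C □ K₂↔)) x ≈ product λ k → x - μ (position k)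
    charPoly-□ = charPoly-eigenbasis AS≋Sμ detS≉0

    eigenvalues : List.List ℂ
    eigenvalues = List.tabulate (μ ∘ position)

    isSpectrum : IsSpectrum (adjacency (C □ K₂↔)) eigenvalues
    isSpectrum = isSpectrum-eigenbasis AS≋Sμ detS≉0

    energy : sumAbsRe eigenvalues ℝ.≈ ℝ.fromℕ (2 ℕ.* n)
    energy = ℝ.trans (ℝ.reflexive (foldr-map-tabulate (μ ∘ position)))
      (ℝ.trans (sum-pairsℝ positions (λ x → ℝ.∣ re (μ x) ∣))
      (ℝ.trans (sumℝ-cong λ j → pair (norm≈1⇒-1≤re≤1 {z j} (norm-z j)))
      (ℝ.trans (twos n) (ℝ.reflexive (≡.cong ℝ.fromℕ (ℕ.*-comm n 2))))))
      where
      open Determinant ℝ.commutativeRing using () renaming (sum to sumℝ; sum-cong-≋ to sumℝ-cong)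
      open PairSums ℝ.commutativeRing using () renaming (sum-pairs to sum-pairsℝ)

      foldr-map-tabulate : ∀ {m} (f : Fin m → ℂ) →
        sumAbsRe (List.tabulate f) ≡ sumℝ λ k → ℝ.∣ re (f k) ∣
      foldr-map-tabulate {zero}  f = ≡.refl
      foldr-map-tabulate {suc m} f = ≡.cong (ℝ.∣ re (f zero) ∣ ℝ.+_) (foldr-map-tabulate (f ∘ suc))

      pair : ∀ {x} → ℝ.- ℝ.1# ℝ.≤ x × x ℝ.≤ ℝ.1# →
             ℝ.∣ x ℝ.+ ℝ.1# ∣ ℝ.+ ℝ.∣ x ℝ.+ ℝ.- ℝ.1# ∣ ℝ.≈ ℝ.1# ℝ.+ ℝ.1#
      pair {x} (-1≤x , x≤1) = ℝ.trans
        (ℝ.+-cong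
          (ℝ.∣∣-nonneg (ℝ.0≤⇒≤ (ℝ.≤⇒0≤ -1≤x)
            (ℝ.solve 1 (λ x → x ℝ.:+ ℝ.:1 ℝ.:- ℝ.:0 ℝ.:= x ℝ.:- (ℝ.:- ℝ.:1)) ℝ.refl x)))
          (ℝ.∣∣-nonpos (ℝ.0≤⇒≤ (ℝ.≤⇒0≤ x≤1)
            (ℝ.solve 1 (λ x → ℝ.:0 ℝ.:- (x ℝ.:+ ℝ.:- ℝ.:1) ℝ.:= ℝ.:1 ℝ.:- x) ℝ.refl x))))
        (ℝ.solve 1 (λ x → x ℝ.:+ ℝ.:1 ℝ.:+ ℝ.:- (x ℝ.:+ ℝ.:- ℝ.:1) ℝ.:= ℝ.:1 ℝ.:+ ℝ.:1)
          ℝ.refl x)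

      twos : ∀ m → sumℝ {m} (λ _ → ℝ.1# ℝ.+ ℝ.1#) ℝ.≈ ℝ.fromℕ (m ℕ.* 2)
      twos zero    = ℝ.refl
      twos (suc m) = ℝ.trans (ℝ.+-congˡ (twos m)) (ℝ.+-assoc ℝ.1# ℝ.1# (ℝ.fromℕ (m ℕ.* 2)))

    hasEnergy : HasEnergy (C □ K₂↔) (ℝ.fromℕ (2 ℕ.* n))
    hasEnergy = eigenvalues , isSpectrum , energy

  -- Comparison of the two products.

  module Main (n : ℕ) (2≤n : 2 ℕ.≤ n) {C 𝐂 : Sidigraph}
    (cycle⁺ : IsSignedCycle Sign.+ n C) (cycle⁻ : IsSignedCycle Sign.- n 𝐂) where

    0<n : 0 ℕ.< n
    0<n = ℕ.<⇒≤ 2≤n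

    root : PrimitiveRoot n
    root = primitiveRoot n 2≤n

    open PrimitiveRoot root
    module C⁺ = Spectrum C cycle⁺ 0<n root {1#} (1#^ n) norm-1#
    module C⁻ = Spectrum 𝐂 cycle⁻ 0<n root {ζ} ζ^n norm-ζ
    module Roots⁻ = Roots root { Sign.- } {ζ} ζ^n norm-ζ

    -- The factor of `z = 1` and `τ = 1` vanishes; `k` is the index of that pair in the enumeration.
    charPoly⁺-2≈0 : charPoly (adjacency (C □ K₂↔)) (1# + 1#) ≈ 0#
    charPoly⁺-2≈0 = trans (C⁺.charPoly-□ (1# + 1#)) (product-≈0 k factor≈0)
      where
      0F : Fin n
      0F = fromℕ< 0<n

      k : Fin C⁺.N
      k = Inverse.from C⁺.positions (0F , zero)

      z₀≈1 : 1# * (ζ * ζ) ^ toℕ 0F ≈ 1#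
      z₀≈1 = trans (*-identityˡ ((ζ * ζ) ^ toℕ 0F))
        (reflexive (≡.cong ((ζ * ζ) ^_) (Fin.toℕ-fromℕ< 0<n)))

      factor≈0 : (1# + 1#) - C⁺.μ (C⁺.position k) ≈ 0#
      factor≈0 = begin
        (1# + 1#) - C⁺.μ (C⁺.position k)
          ≡⟨ ≡.cong (λ x → (1# + 1#) - C⁺.μ x) (Inverse.strictlyInverseˡ C⁺.positions (0F , zero)) ⟩
        (1# + 1#) - (1# * (ζ * ζ) ^ toℕ 0F + 1#)
          ≈⟨ +-congˡ {1# + 1#} (-‿cong (+-congʳ {1#} z₀≈1)) ⟩
        (1# + 1#) - (1# + 1#)
          ≈⟨ -‿inverseʳ (1# + 1#) ⟩
        0# ∎

    charPoly⁻-2≉0 : ¬ (charPoly (adjacency (𝐂 □ K₂↔)) (1# + 1#) ≈ 0#)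
    charPoly⁻-2≉0 p≈0 = product-≉0 (λ k → factor≉0 (C⁻.position k))
      (trans (sym (C⁻.charPoly-□ (1# + 1#))) p≈0)
      where
      1≉-1 : ¬ (1# ≈ - 1#)
      1≉-1 (1≈-1 , _) = ℝ.+-pos ℝ.0<1 ℝ.0≤1
        (ℝ.≤-reflexive (ℝ.trans (ℝ.+-congˡ 1≈-1) (ℝ.-‿inverseʳ ℝ.1#)))

      factor≉0 : ∀ x → ¬ ((1# + 1#) - C⁻.μ x ≈ 0#)
      -- From `z + 1 = 2` it would follow that `z = 1`, and then `1 = zⁿ = -1`.
      factor≉0 (j , zero) eq = 1≉-1 (begin
        1#                 ≈⟨ 1#^ n ⟨
        1# ^ n             ≈⟨ ^-congˡ n z≈1 ⟨
        Roots⁻.z j ^ n     ≈⟨ Roots⁻.z^n j ⟩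
        - 1#               ∎)
        where
        z≈1 : Roots⁻.z j ≈ 1#
        z≈1 = sym (x∙y⁻¹≈ε⇒x≈y 1# (Roots⁻.z j) (trans
          (solve 1 (λ z → :1 :- z := :1 :+ :1 :- (z :+ :1)) refl (Roots⁻.z j)) eq))
      -- Here z would be 3, but it lies on the unit circle.
      factor≉0 (j , suc zero) (eq , _) = ℝ.+-pos (ℝ.+-pos ℝ.0<1 ℝ.0≤1)
        (ℝ.≤⇒0≤ (proj₂ (norm≈1⇒-1≤re≤1 {Roots⁻.z j} (Roots⁻.norm-z j))))
        (ℝ.≤-reflexive (ℝ.trans
          (ℝ.solve 1 (λ x →
              ℝ.:1 ℝ.:+ ℝ.:1 ℝ.:+ (ℝ.:1 ℝ.:- x) ℝ.:= ℝ.:1 ℝ.:+ ℝ.:1 ℝ.:- (x ℝ.:+ ℝ.:- ℝ.:1))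
            ℝ.refl (re (Roots⁻.z j))) eq))

    -- A common list of eigenvalues forces the two characteristic polynomials to agree at every
    -- point, in particular at 2.
    noncospectral : ¬ Cospectral (𝐂 □ K₂↔) (C □ K₂↔)
    noncospectral (_ , zs , (_ , spectrum⁻) , (_ , spectrum⁺)) = charPoly⁻-2≉0
      (trans (spectrum⁻ (1# + 1#)) (trans (sym (spectrum⁺ (1# + 1#))) charPoly⁺-2≈0))

open import Data.Nat using (ℕ; _≤_; _*_)

corollary6p2 :
    {c ℓ : Level} (R : CompleteOrderedField c ℓ) →
    let open CompleteOrderedField R using (fromℕ) in
    let open Spectral R in
    (n : ℕ) → 2 ≤ n →
    (C 𝐂 : Sidigraph) → IsSignedCycle Sign.+ n C → IsSignedCycle Sign.- n 𝐂 →
    HasEnergy (𝐂 □ K₂↔) (fromℕ (2 * n)) ×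
    HasEnergy (C □ K₂↔) (fromℕ (2 * n)) ×
    order (𝐂 □ K₂↔) ≡ 2 * n ×
    order (C □ K₂↔) ≡ 2 * n ×
    ¬ Cospectral (𝐂 □ K₂↔) (C □ K₂↔)
corollary6p2 R n 2≤n C 𝐂 cycle⁺ cycle⁻ =
  C⁻.hasEnergy , C⁺.hasEnergy , C⁻.order-□ , C⁺.order-□ , noncospectral
  where open CycleTimesK₂.Main R n 2≤n cycle⁺ cycle⁻
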